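{- There are constants $c,C>0$ such that for all sufficiently large $n$ and all $p,q\in(0,1)$ with $\hat p=\frac{p}{p+q}\ge c\frac{\log n}{n}$, with probability at least $1-1/n$ the flooding time of the stationary edge-MEG $\mathcal{M}(n,p,q)$ is at least $C\,\frac{\log n}{\log(n\hat p)}$.
   Context: The edge-MEG $\mathcal{M}(n,p,q)=\{G_t\}$ on node set $[n]$: for each pair $e\in\binom{[n]}{2}$ there is an independent two-state Markov chain $X_t(e)\in\{0,1\}$ with $\Pr[X_{t+1}(e)=1\mid X_t(e)=0]=p$ and $\Pr[X_{t+1}(e)=0\mid X_t(e)=1]=q$; $G_t=([n],\{e:X_t(e)=1\})$. It is stationary when $G_0$ is drawn from the stationary distribution, which is the Erdős–Rényi graph $G_{n,\hat p}$, $\hat p=p/(p+q)$ (so every $G_t$ has law $G_{n,\hat p}$). Flooding from source $s$: $I_0=\{s\}$, $I_{t+1}=I_t\cup N_t(I_t)$ where $N_t(I)$ is the set of nodes outside $I$ adjacent in $G_t$ to some node of $I$; $T(s)$ is the first $t$ with $I_t=[n]$; the flooding time is $\max_s T(s)$. Logarithms are natural. -}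

module Defs where

open import Data.Bool using (Bool; true; false; if_then_else_)
import Data.Bool.Properties as Bool
open import Data.Empty using (⊥-elim)
open import Data.Fin using (Fin; zero; suc; toℕ)
open import Data.Fin.Properties using (any?)
open import Data.Fin.Subset using (Subset; ⁅_⁆; _∪_; ⊤)
open import Data.Fin.Subset.Properties using (_∈?_)
open import Data.Integer as ℤ using (+_)
import Data.Integer.Properties as ℤ
open import Data.List using (List; []; _∷_; map; concatMap)
open import Data.Nat as ℕ using (ℕ; zero; suc; s≤s; z≤n)
import Data.Nat.Properties as ℕ
open import Data.Product using (Σ; ∃; _×_; _,_; proj₁; proj₂; map₁)
open import Data.Rational
open import Data.Rational.Properties
open import Data.Rational.Solver using (module +-*-Solver)
open import Data.Rational.Unnormalised as ℚᵘ using (mkℚᵘ)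
import Data.Rational.Unnormalised.Properties as ℚᵘ
open import Data.Sum using (inj₁; inj₂)
open import Data.Vec as Vec using (Vec; []; _∷_; lookup; tabulate)
open import Relation.Binary.PropositionalEquality using (_≡_; _≢_; refl; sym; trans; cong; cong₂; subst; subst₂; module ≡-Reasoning)
open import Relation.Nullary using (does; yes; no; ¬?; _×-dec_)

open +-*-Solver

*-mono-≤-nonNeg : ∀ {a b c d} → 0ℚ ≤ a → a ≤ b → 0ℚ ≤ c → c ≤ d → a * c ≤ b * d
*-mono-≤-nonNeg {a} {b} {c} {d} 0≤a a≤b 0≤c c≤d = ≤-trans
  (*-monoʳ-≤-nonNeg c {{nonNegative 0≤c}} a≤b)
  (*-monoˡ-≤-nonNeg b {{nonNegative (≤-trans 0≤a a≤b)}} c≤d)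

0≤* : ∀ {a b} → 0ℚ ≤ a → 0ℚ ≤ b → 0ℚ ≤ a * b
0≤* {a} {b} 0≤a 0≤b = subst (_≤ a * b) (*-zeroˡ 0ℚ) (*-mono-≤-nonNeg ≤-refl 0≤a ≤-refl 0≤b)

0<* : ∀ {a b} → 0ℚ < a → 0ℚ < b → 0ℚ < a * b
0<* {a} {b} 0<a 0<b = positive⁻¹ (a * b) {{pos*pos⇒pos a {{positive 0<a}} b {{positive 0<b}}}}

0≤+ : ∀ {a b} → 0ℚ ≤ a → 0ℚ ≤ b → 0ℚ ≤ a + b
0≤+ = +-mono-≤

0<1 : 0ℚ < 1ℚ
0<1 = positive⁻¹ 1ℚ

∣-∣-triangle : ∀ x y z → ∣ x - z ∣ ≤ ∣ x - y ∣ + ∣ y - z ∣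
∣-∣-triangle x y z = subst (λ w → ∣ w ∣ ≤ ∣ x - y ∣ + ∣ y - z ∣)
  (solve 3 (λ x y z → (x :- y) :+ (y :- z) := x :- z) refl x y z)
  (∣p+q∣≤∣p∣+∣q∣ (x - y) (y - z))

∣-∣-swap : ∀ x y → ∣ x - y ∣ ≡ ∣ y - x ∣
∣-∣-swap x y = trans (sym (∣-p∣≡∣p∣ (x - y)))
  (cong ∣_∣ (solve 2 (λ x y → :- (x :- y) := y :- x) refl x y))

-- recip 0 = 0.
recip : ℚ → ℚ
recip q with q ≟ 0ℚ
... | yes _   = 0ℚ
... | no  q≢0 = 1/_ q {{≢-nonZero q≢0}}

*-recip : ∀ {q} → 0ℚ < q → q * recip q ≡ 1ℚ
*-recip {q} 0<q with q ≟ 0ℚ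
... | yes q≡0 = ⊥-elim (<-irrefl (sym q≡0) 0<q)
... | no  q≢0 = *-inverseʳ q {{≢-nonZero q≢0}}

recip-pos : ∀ {q} → 0ℚ < q → 0ℚ < recip q
recip-pos {q} 0<q = *-cancelˡ-<-nonNeg q {{nonNegative (<⇒≤ 0<q)}}
  (subst₂ _<_ (sym (*-zeroʳ q)) (sym (*-recip 0<q)) 0<1)

recip-≤ : ∀ {q s} → 0ℚ < q → 1ℚ ≤ q * s → recip q ≤ s
recip-≤ {q} {s} 0<q 1≤qs = subst₂ _≤_
  (*-identityʳ (recip q))
  (trans (solve 3 (λ r q s → r :* (q :* s) := q :* r :* s) refl (recip q) q s)
    (trans (cong (_* s) (*-recip 0<q)) (*-identityˡ s)))
  (*-monoˡ-≤-nonNeg (recip q) {{nonNegative (<⇒≤ (recip-pos 0<q))}} 1≤qs)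

recip-antimono : ∀ {d q} → 0ℚ < d → d ≤ q → recip q ≤ recip d
recip-antimono {d} {q} 0<d d≤q = recip-≤ (<-≤-trans 0<d d≤q)
  (subst (_≤ q * recip d) (*-recip 0<d)
    (*-monoʳ-≤-nonNeg (recip d) {{nonNegative (<⇒≤ (recip-pos 0<d))}} d≤q))

recip-diff : ∀ {a b s} → 0ℚ < a → 0ℚ < b → recip a ≤ s → recip b ≤ s →
             ∣ recip a - recip b ∣ ≤ ∣ a - b ∣ * (s * s)
recip-diff {a} {b} {s} 0<a 0<b ra≤s rb≤s = subst (_≤ ∣ a - b ∣ * (s * s)) (sym eq)
  (*-mono-≤-nonNeg (0≤∣p∣ (a - b)) ≤-refl (0≤* 0≤ra 0≤rb) (*-mono-≤-nonNeg 0≤ra ra≤s 0≤rb rb≤s))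
  where
  0≤ra = <⇒≤ (recip-pos 0<a)
  0≤rb = <⇒≤ (recip-pos 0<b)
  eq₁ : recip a - recip b ≡ (b - a) * (recip a * recip b)
  eq₁ = begin
    recip a - recip b
      ≡⟨ cong₂ _-_ (sym (*-identityʳ (recip a))) (sym (*-identityʳ (recip b))) ⟩
    recip a * 1ℚ - recip b * 1ℚ
      ≡⟨ cong₂ (λ u v → recip a * u - recip b * v) (sym (*-recip 0<b)) (sym (*-recip 0<a)) ⟩
    recip a * (b * recip b) - recip b * (a * recip a)
      ≡⟨ solve 4 (λ a b u v → u :* (b :* v) :- v :* (a :* u) := (b :- a) :* (u :* v))
           refl a b (recip a) (recip b) ⟩
    (b - a) * (recip a * recip b) ∎
    where open ≡-Reasoning
  eq : ∣ recip a - recip b ∣ ≡ ∣ a - b ∣ * (recip a * recip b)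
  eq = trans (cong ∣_∣ eq₁) (trans (∣p*q∣≡∣p∣*∣q∣ (b - a) _)
    (cong₂ _*_ (∣-∣-swap b a) (0≤p⇒∣p∣≡p (0≤* 0≤ra 0≤rb))))

ℕ→ℚ : ℕ → ℚ
ℕ→ℚ n = + n / 1

private
  toℚᵘ-ℕ→ℚ : ∀ n → toℚᵘ (ℕ→ℚ n) ℚᵘ.≃ mkℚᵘ (+ n) 0
  toℚᵘ-ℕ→ℚ n = toℚᵘ-fromℚᵘ (mkℚᵘ (+ n) 0)

ℕ→ℚ-+ : ∀ m n → ℕ→ℚ (m ℕ.+ n) ≡ ℕ→ℚ m + ℕ→ℚ n
ℕ→ℚ-+ m n = toℚᵘ-injective (ℚᵘ.≃-trans (toℚᵘ-ℕ→ℚ (m ℕ.+ n)) (ℚᵘ.≃-sym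
  (ℚᵘ.≃-trans (toℚᵘ-homo-+ (ℕ→ℚ m) (ℕ→ℚ n))
  (ℚᵘ.≃-trans (ℚᵘ.+-cong (toℚᵘ-ℕ→ℚ m) (toℚᵘ-ℕ→ℚ n))
  (ℚᵘ.*≡* (cong (ℤ._* + 1) (cong₂ ℤ._+_ (ℤ.*-identityʳ (+ m)) (ℤ.*-identityʳ (+ n)))))))))

ℕ→ℚ-* : ∀ m n → ℕ→ℚ (m ℕ.* n) ≡ ℕ→ℚ m * ℕ→ℚ n
ℕ→ℚ-* m n = toℚᵘ-injective (ℚᵘ.≃-trans (toℚᵘ-ℕ→ℚ (m ℕ.* n)) (ℚᵘ.≃-sym
  (ℚᵘ.≃-trans (toℚᵘ-homo-* (ℕ→ℚ m) (ℕ→ℚ n))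
  (ℚᵘ.≃-trans (ℚᵘ.*-cong (toℚᵘ-ℕ→ℚ m) (toℚᵘ-ℕ→ℚ n))
  (ℚᵘ.*≡* (cong (ℤ._* + 1) (sym (ℤ.pos-* m n))))))))

0≤ℕ→ℚ : ∀ n → 0ℚ ≤ ℕ→ℚ n
0≤ℕ→ℚ n = nonNegative⁻¹ (ℕ→ℚ n) {{normalize-nonNeg n 1}}

ℕ→ℚ-mono : ∀ {m n} → m ℕ.≤ n → ℕ→ℚ m ≤ ℕ→ℚ n
ℕ→ℚ-mono {m} {n} m≤n = subst₂ _≤_ (+-identityʳ (ℕ→ℚ m))
  (trans (sym (ℕ→ℚ-+ m (n ℕ.∸ m))) (cong ℕ→ℚ (ℕ.m+[n∸m]≡n m≤n)))
  (+-monoʳ-≤ (ℕ→ℚ m) (0≤ℕ→ℚ (n ℕ.∸ m)))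

0<ℕ→ℚ : ∀ n → 0ℚ < ℕ→ℚ (suc n)
0<ℕ→ℚ n = <-≤-trans 0<1 (ℕ→ℚ-mono {1} {suc n} (s≤s z≤n))

archimedean : ∀ ε → 0ℚ < ε → ∃ λ N → ∀ n → N ℕ.≤ n → recip (ℕ→ℚ (suc n)) ≤ ε
archimedean (mkℚ (+ zero) d c) 0<ε = ⊥-elim (<-irrefl (sym (↥p≡0⇒p≡0 _ refl)) 0<ε)
archimedean (mkℚ ℤ.-[1+ k ] d c) (*<* ())
archimedean ε@(mkℚ (+ suc k) d c) 0<ε = d , λ n d≤n → recip-≤ (0<ℕ→ℚ n)
  (≤-trans one (*-monoʳ-≤-nonNeg ε {{nonNegative (<⇒≤ 0<ε)}} (ℕ→ℚ-mono {suc d} {suc n} (s≤s d≤n))))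
  where
  one : 1ℚ ≤ ℕ→ℚ (suc d) * ε
  one = toℚᵘ-cancel-≤ (ℚᵘ.≤-respʳ-≃
    (ℚᵘ.≃-sym (ℚᵘ.≃-trans (toℚᵘ-homo-* (ℕ→ℚ (suc d)) ε) (ℚᵘ.*-congʳ (toℚᵘ-ℕ→ℚ (suc d)))))
    (ℚᵘ.*≤* (ℤ.+≤+ (subst₂ ℕ._≤_ (sym (trans (ℕ.*-identityˡ _) (ℕ.*-identityˡ _)))
      (sym (ℕ.*-identityʳ _)) (ℕ.m≤m*n (suc d) (suc k))))))

IsCauchy : (ℕ → ℚ) → Set
IsCauchy x = ∀ ε → 0ℚ < ε → ∃ λ N → ∀ m n → N ℕ.≤ m → N ℕ.≤ n → ∣ x m - x n ∣ ≤ ε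

-- Sequences with the same limit are not identified; _<ℝ_ and _≤ℝ_ compare limits.
record ℝ : Set where
  constructor mkℝ
  field
    seq    : ℕ → ℚ
    cauchy : IsCauchy seq
open ℝ public

infix 4 _<ℝ_ _≤ℝ_

_<ℝ_ : ℝ → ℝ → Set
x <ℝ y = ∃ λ ε → 0ℚ < ε × ∃ λ N → ∀ n → N ℕ.≤ n → seq x n + ε ≤ seq y n

_≤ℝ_ : ℝ → ℝ → Set
x ≤ℝ y = ∀ ε → 0ℚ < ε → ∃ λ N → ∀ n → N ℕ.≤ n → seq x n ≤ seq y n + ε

cauchy-by : ∀ x K → 0ℚ < K →
            (∀ ε → 0ℚ < ε → ∃ λ N → ∀ m n → N ℕ.≤ m → N ℕ.≤ n → ∣ x m - x n ∣ ≤ K * ε) →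
            IsCauchy x
cauchy-by x K 0<K h ε 0<ε =
  let N , b = h (recip K * ε) (0<* (recip-pos 0<K) 0<ε)
  in N , λ m n N≤m N≤n → subst (∣ x m - x n ∣ ≤_) eq (b m n N≤m N≤n)
  where
  eq : K * (recip K * ε) ≡ ε
  eq = trans (sym (*-assoc K (recip K) ε)) (trans (cong (_* ε) (*-recip 0<K)) (*-identityˡ ε))

bounded : ∀ (x : ℝ) → ∃ λ B → 0ℚ < B × ∃ λ N → ∀ n → N ℕ.≤ n → ∣ seq x n ∣ ≤ B
bounded x =
  let N , b = cauchy x 1ℚ 0<1
  in 1ℚ + ∣ seq x N ∣ , <-≤-trans 0<1 (subst (_≤ 1ℚ + ∣ seq x N ∣) (+-identityʳ 1ℚ) (+-monoʳ-≤ 1ℚ (0≤∣p∣ (seq x N))))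
   , N , λ n N≤n → subst (λ w → ∣ w ∣ ≤ 1ℚ + ∣ seq x N ∣)
           (solve 2 (λ a b → (a :- b) :+ b := a) refl (seq x n) (seq x N))
           (≤-trans (∣p+q∣≤∣p∣+∣q∣ (seq x n - seq x N) (seq x N))
             (+-monoˡ-≤ ∣ seq x N ∣ (b n N N≤n ℕ.≤-refl)))

fromℚ : ℚ → ℝ
fromℚ q = mkℝ (λ _ → q) λ ε 0<ε → 0 , λ _ _ _ _ →
  subst (λ w → ∣ w ∣ ≤ ε) (sym (+-inverseʳ q)) (<⇒≤ 0<ε)

fromℕ : ℕ → ℝ
fromℕ n = fromℚ (ℕ→ℚ n)

0ℝ 1ℝ : ℝ
0ℝ = fromℚ 0ℚ
1ℝ = fromℚ 1ℚ

infixl 6 _+ℝ_ _-ℝ_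
infixl 7 _*ℝ_ _/ℝ_[_]
infix  8 -ℝ_

+-cauchy : ∀ x y → IsCauchy (λ n → seq x n + seq y n)
+-cauchy x y = cauchy-by (λ n → seq x n + seq y n) (1ℚ + 1ℚ) (positive⁻¹ (1ℚ + 1ℚ)) λ ε 0<ε →
  let M , b = cauchy x ε 0<ε
      N , c = cauchy y ε 0<ε
  in M ℕ.⊔ N , λ m n ≤m ≤n → subst (∣ seq x m + seq y m - (seq x n + seq y n) ∣ ≤_)
       (solve 1 (λ e → e :+ e := (con 1ℚ :+ con 1ℚ) :* e) refl ε)
       (≤-trans
         (subst (λ w → ∣ w ∣ ≤ ∣ seq x m - seq x n ∣ + ∣ seq y m - seq y n ∣)
           (solve 4 (λ a b c d → (a :- b) :+ (c :- d) := (a :+ c) :- (b :+ d)) refl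
             (seq x m) (seq x n) (seq y m) (seq y n))
           (∣p+q∣≤∣p∣+∣q∣ (seq x m - seq x n) (seq y m - seq y n)))
         (+-mono-≤ (b m n (ℕ.m⊔n≤o⇒m≤o M N ≤m) (ℕ.m⊔n≤o⇒m≤o M N ≤n))
                   (c m n (ℕ.m⊔n≤o⇒n≤o M N ≤m) (ℕ.m⊔n≤o⇒n≤o M N ≤n))))

_+ℝ_ : ℝ → ℝ → ℝ
x +ℝ y = mkℝ (λ n → seq x n + seq y n) (+-cauchy x y)

neg-cauchy : ∀ x → IsCauchy (λ n → - seq x n)
neg-cauchy x ε 0<ε =
  let N , b = cauchy x ε 0<ε
  in N , λ m n N≤m N≤n → subst (_≤ ε)
       (trans (∣-∣-swap (seq x m) (seq x n))
         (cong ∣_∣ (solve 2 (λ a b → b :- a := :- a :- :- b) refl (seq x m) (seq x n))))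
       (b m n N≤m N≤n)

-ℝ_ : ℝ → ℝ
-ℝ x = mkℝ (λ n → - seq x n) (neg-cauchy x)

_-ℝ_ : ℝ → ℝ → ℝ
x -ℝ y = x +ℝ (-ℝ y)

*-cauchy : ∀ x y → IsCauchy (λ n → seq x n * seq y n)
*-cauchy x y =
  let A , 0<A , M , a = bounded x
      B , 0<B , N , b = bounded y
  in cauchy-by (λ n → seq x n * seq y n) (A + B) (+-mono-< 0<A 0<B) λ ε 0<ε →
    let O , c = cauchy x ε 0<ε
        P , d = cauchy y ε 0<ε
    in (M ℕ.⊔ N) ℕ.⊔ (O ℕ.⊔ P) , λ m n ≤m ≤n →
      let xm = seq x m
          xn = seq x n
          ym = seq y m
          yn = seq y n
          M≤m = ℕ.m⊔n≤o⇒m≤o M N (ℕ.m⊔n≤o⇒m≤o (M ℕ.⊔ N) (O ℕ.⊔ P) ≤m)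
          N≤n = ℕ.m⊔n≤o⇒n≤o M N (ℕ.m⊔n≤o⇒m≤o (M ℕ.⊔ N) (O ℕ.⊔ P) ≤n)
          OP≤m = ℕ.m⊔n≤o⇒n≤o (M ℕ.⊔ N) (O ℕ.⊔ P) ≤m
          OP≤n = ℕ.m⊔n≤o⇒n≤o (M ℕ.⊔ N) (O ℕ.⊔ P) ≤n
      in ≤-trans
        (subst (λ w → ∣ w ∣ ≤ ∣ xm * (ym - yn) ∣ + ∣ (xm - xn) * yn ∣)
          (solve 4 (λ a b c d → a :* (c :- d) :+ (a :- b) :* d := a :* c :- b :* d) refl xm xn ym yn)
          (∣p+q∣≤∣p∣+∣q∣ (xm * (ym - yn)) ((xm - xn) * yn)))
        (subst₂ _≤_
          (cong₂ _+_ (sym (∣p*q∣≡∣p∣*∣q∣ xm (ym - yn))) (sym (∣p*q∣≡∣p∣*∣q∣ (xm - xn) yn)))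
          (solve 3 (λ A B e → A :* e :+ e :* B := (A :+ B) :* e) refl A B ε)
          (+-mono-≤
            (*-mono-≤-nonNeg (0≤∣p∣ xm) (a m M≤m)
              (0≤∣p∣ (ym - yn)) (d m n (ℕ.m⊔n≤o⇒n≤o O P OP≤m) (ℕ.m⊔n≤o⇒n≤o O P OP≤n)))
            (*-mono-≤-nonNeg (0≤∣p∣ (xm - xn)) (c m n (ℕ.m⊔n≤o⇒m≤o O P OP≤m) (ℕ.m⊔n≤o⇒m≤o O P OP≤n))
              (0≤∣p∣ yn) (b n N≤n))))

_*ℝ_ : ℝ → ℝ → ℝ
x *ℝ y = mkℝ (λ n → seq x n * seq y n) (*-cauchy x y)

bounded-below : ∀ {x} → 0ℝ <ℝ x → ∃ λ δ → 0ℚ < δ × ∃ λ N → ∀ n → N ℕ.≤ n → δ ≤ seq x n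
bounded-below {x} (δ , 0<δ , N , b) = δ , 0<δ , N , λ n N≤n →
  subst (_≤ seq x n) (+-identityˡ δ) (b n N≤n)

pos-from-bound : ∀ {x} → (∃ λ δ → 0ℚ < δ × ∃ λ N → ∀ n → N ℕ.≤ n → δ ≤ seq x n) → 0ℝ <ℝ x
pos-from-bound {x} (δ , 0<δ , N , b) = δ , 0<δ , N , λ n N≤n →
  subst (_≤ seq x n) (sym (+-identityˡ δ)) (b n N≤n)

recip-cauchy : ∀ x → 0ℝ <ℝ x → IsCauchy (λ n → recip (seq x n))
recip-cauchy x 0<x =
  let δ , 0<δ , M , a = bounded-below {x} 0<x
      r = recip δ
      0<r = recip-pos 0<δ
  in cauchy-by (λ n → recip (seq x n)) (r * r) (0<* 0<r 0<r) λ ε 0<ε →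
    let N , b = cauchy x ε 0<ε
    in M ℕ.⊔ N , λ m n ≤m ≤n →
      let am = a m (ℕ.m⊔n≤o⇒m≤o M N ≤m)
          an = a n (ℕ.m⊔n≤o⇒m≤o M N ≤n)
      in ≤-trans
        (recip-diff (<-≤-trans 0<δ am) (<-≤-trans 0<δ an) (recip-antimono 0<δ am) (recip-antimono 0<δ an))
        (subst (∣ seq x m - seq x n ∣ * (r * r) ≤_) (*-comm ε (r * r))
          (*-monoʳ-≤-nonNeg (r * r) {{nonNegative (<⇒≤ (0<* 0<r 0<r))}}
            (b m n (ℕ.m⊔n≤o⇒n≤o M N ≤m) (ℕ.m⊔n≤o⇒n≤o M N ≤n))))

inv : ∀ x → 0ℝ <ℝ x → ℝ
inv x 0<x = mkℝ (λ n → recip (seq x n)) (recip-cauchy x 0<x)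

_/ℝ_[_] : ∀ (x y : ℝ) → 0ℝ <ℝ y → ℝ
x /ℝ y [ 0<y ] = x *ℝ inv y 0<y

fromℕ-pos : ∀ n .{{_ : ℕ.NonZero n}} → 0ℝ <ℝ fromℕ n
fromℕ-pos (suc n) = pos-from-bound {fromℕ (suc n)} (ℕ→ℚ (suc n) , 0<ℕ→ℚ n , 0 , λ _ _ → ≤-refl)

+ℝ-pos : ∀ {x y} → 0ℝ <ℝ x → 0ℝ <ℝ y → 0ℝ <ℝ x +ℝ y
+ℝ-pos {x} {y} 0<x 0<y =
  let δ , 0<δ , M , a = bounded-below {x} 0<x
      γ , 0<γ , N , b = bounded-below {y} 0<y
  in pos-from-bound {x +ℝ y} (δ + γ , +-mono-< 0<δ 0<γ , M ℕ.⊔ N , λ n ≤n →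
       +-mono-≤ (a n (ℕ.m⊔n≤o⇒m≤o M N ≤n)) (b n (ℕ.m⊔n≤o⇒n≤o M N ≤n)))

*ℝ-pos : ∀ {x y} → 0ℝ <ℝ x → 0ℝ <ℝ y → 0ℝ <ℝ x *ℝ y
*ℝ-pos {x} {y} 0<x 0<y =
  let δ , 0<δ , M , a = bounded-below {x} 0<x
      γ , 0<γ , N , b = bounded-below {y} 0<y
  in pos-from-bound {x *ℝ y} (δ * γ , 0<* 0<δ 0<γ , M ℕ.⊔ N , λ n ≤n →
       *-mono-≤-nonNeg (<⇒≤ 0<δ) (a n (ℕ.m⊔n≤o⇒m≤o M N ≤n)) (<⇒≤ 0<γ) (b n (ℕ.m⊔n≤o⇒n≤o M N ≤n)))

inv-pos : ∀ {x} (0<x : 0ℝ <ℝ x) → 0ℝ <ℝ inv x 0<x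
inv-pos {x} 0<x =
  let δ , 0<δ , M , a = bounded-below {x} 0<x
      B , 0<B , N , b = bounded x
  in pos-from-bound {inv x 0<x} (recip B , recip-pos 0<B , M ℕ.⊔ N , λ n ≤n →
       let 0<xn = <-≤-trans 0<δ (a n (ℕ.m⊔n≤o⇒m≤o M N ≤n))
       in recip-antimono 0<xn
            (subst (_≤ B) (0≤p⇒∣p∣≡p (<⇒≤ 0<xn)) (b n (ℕ.m⊔n≤o⇒n≤o M N ≤n))))

/ℝ-pos : ∀ {x y} → 0ℝ <ℝ x → (0<y : 0ℝ <ℝ y) → 0ℝ <ℝ x /ℝ y [ 0<y ]
/ℝ-pos {x} {y} 0<x 0<y = *ℝ-pos {x} {inv y 0<y} 0<x (inv-pos {y} 0<y)

sumℚ : ℕ → (ℕ → ℚ) → ℚ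
sumℚ zero    f = 0ℚ
sumℚ (suc n) f = sumℚ n f + f n

-- The left Riemann sum of ∫₁ᵘ dt/t on a equal steps:
-- step (u - 1)/a, i-th node 1 + i(u - 1)/a.
riemann : ℕ → ℚ → ℚ
riemann a u = sumℚ a λ i → (u - 1ℚ) * recip (ℕ→ℚ a + ℕ→ℚ i * (u - 1ℚ))

sumℚ-diff : ∀ n {f g b} → (∀ i → i ℕ.< n → ∣ f i - g i ∣ ≤ b) →
            ∣ sumℚ n f - sumℚ n g ∣ ≤ ℕ→ℚ n * b
sumℚ-diff zero    {b = b} h = ≤-reflexive (sym (*-zeroˡ b))
sumℚ-diff (suc n) {f} {g} {b} h = ≤-trans
  (subst (λ w → ∣ w ∣ ≤ ∣ sumℚ n f - sumℚ n g ∣ + ∣ f n - g n ∣)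
    (solve 4 (λ a b c d → (a :- b) :+ (c :- d) := (a :+ c) :- (b :+ d)) refl
      (sumℚ n f) (sumℚ n g) (f n) (g n))
    (∣p+q∣≤∣p∣+∣q∣ (sumℚ n f - sumℚ n g) (f n - g n)))
  (subst (∣ sumℚ n f - sumℚ n g ∣ + ∣ f n - g n ∣ ≤_) eq
    (+-mono-≤ (sumℚ-diff n {f} {g} (λ i i<n → h i (ℕ.m<n⇒m<1+n i<n))) (h n (ℕ.n<1+n n))))
  where
  eq : ℕ→ℚ n * b + b ≡ ℕ→ℚ (suc n) * b
  eq = trans (solve 2 (λ n b → n :* b :+ b := (con 1ℚ :+ n) :* b) refl (ℕ→ℚ n) b)
             (cong (_* b) (sym (ℕ→ℚ-+ 1 n)))

sumℚ-cong : ∀ n {f g} → (∀ i → i ℕ.< n → f i ≡ g i) → sumℚ n f ≡ sumℚ n g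
sumℚ-cong zero    e = refl
sumℚ-cong (suc n) e = cong₂ _+_ (sumℚ-cong n (λ i i<n → e i (ℕ.m<n⇒m<1+n i<n))) (e n (ℕ.n<1+n n))

sumℚ-const : ∀ n c → sumℚ n (λ _ → c) ≡ ℕ→ℚ n * c
sumℚ-const zero    c = sym (*-zeroˡ c)
sumℚ-const (suc n) c = trans (cong (_+ c) (sumℚ-const n c))
  (trans (solve 2 (λ n b → n :* b :+ b := (con 1ℚ :+ n) :* b) refl (ℕ→ℚ n) c)
         (cong (_* c) (sym (ℕ→ℚ-+ 1 n))))

sumℚ-++ : ∀ m k f → sumℚ (m ℕ.+ k) f ≡ sumℚ m f + sumℚ k (λ j → f (m ℕ.+ j))
sumℚ-++ m zero f = trans (cong (λ w → sumℚ w f) (ℕ.+-identityʳ m)) (sym (+-identityʳ (sumℚ m f)))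
sumℚ-++ m (suc k) f = trans (cong (λ w → sumℚ w f) (ℕ.+-suc m k))
  (trans (cong (_+ f (m ℕ.+ k)) (sumℚ-++ m k f)) (+-assoc (sumℚ m f) _ (f (m ℕ.+ k))))

sumℚ-blocks : ∀ a b f → sumℚ (a ℕ.* b) f ≡ sumℚ a (λ i → sumℚ b (λ j → f (i ℕ.* b ℕ.+ j)))
sumℚ-blocks zero    b f = refl
sumℚ-blocks (suc a) b f = trans (cong (λ w → sumℚ w f) (ℕ.+-comm b (a ℕ.* b)))
  (trans (sumℚ-++ (a ℕ.* b) b f)
    (cong (_+ sumℚ b (λ j → f (a ℕ.* b ℕ.+ j))) (sumℚ-blocks a b f)))

node-bound : ∀ {δ y} a i → 0ℚ < δ → δ ≤ 1ℚ → δ ≤ 1ℚ + y → i ℕ.≤ a →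
             ℕ→ℚ a * δ ≤ ℕ→ℚ a + ℕ→ℚ i * y
node-bound {δ} {y} a i 0<δ δ≤1 δ≤1+y i≤a = subst₂ _≤_
  (trans (solve 3 (λ i k d → i :* d :+ k :* d := (i :+ k) :* d) refl (ℕ→ℚ i) (ℕ→ℚ k) δ)
    (cong (_* δ) i+k≡a))
  (trans (solve 3 (λ i k y → i :* (con 1ℚ :+ y) :+ k :* con 1ℚ := (i :+ k) :+ i :* y) refl (ℕ→ℚ i) (ℕ→ℚ k) y)
    (cong (_+ ℕ→ℚ i * y) i+k≡a))
  (+-mono-≤ (*-monoˡ-≤-nonNeg (ℕ→ℚ i) {{nonNegative (0≤ℕ→ℚ i)}} δ≤1+y)
            (*-monoˡ-≤-nonNeg (ℕ→ℚ k) {{nonNegative (0≤ℕ→ℚ k)}} δ≤1))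
  where
  k = a ℕ.∸ i
  i+k≡a : ℕ→ℚ i + ℕ→ℚ k ≡ ℕ→ℚ a
  i+k≡a = trans (sym (ℕ→ℚ-+ i k)) (cong ℕ→ℚ (ℕ.m+[n∸m]≡n i≤a))

node-recip : ∀ {δ q} a → 0ℚ < δ → ℕ→ℚ (suc a) * δ ≤ q →
             0ℚ < q × recip q ≤ recip (ℕ→ℚ (suc a)) * recip δ
node-recip {δ} {q} a 0<δ aδ≤q = 0<q , recip-≤ 0<q (subst (_≤ q * s) one
    (*-monoʳ-≤-nonNeg s {{nonNegative (<⇒≤ 0<s)}} aδ≤q))
  where
  A = ℕ→ℚ (suc a)
  s = recip A * recip δ
  0<A = 0<ℕ→ℚ a
  0<s : 0ℚ < s
  0<s = 0<* (recip-pos 0<A) (recip-pos 0<δ)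
  0<q : 0ℚ < q
  0<q = <-≤-trans (0<* 0<A 0<δ) aδ≤q
  one : (A * δ) * s ≡ 1ℚ
  one = trans (solve 4 (λ a d r t → (a :* d) :* (r :* t) := (a :* r) :* (d :* t)) refl A δ (recip A) (recip δ))
    (trans (cong₂ _*_ (*-recip 0<A) (*-recip 0<δ)) (*-identityˡ 1ℚ))

riemann-lipschitz : ∀ {δ M u v} a → 0ℚ < δ → δ ≤ 1ℚ → δ ≤ u → δ ≤ v → ∣ v - 1ℚ ∣ ≤ M →
  ∣ riemann (suc a) u - riemann (suc a) v ∣ ≤ (recip δ * (1ℚ + M * recip δ)) * ∣ u - v ∣
riemann-lipschitz {δ} {M} {u} {v} a 0<δ δ≤1 δ≤u δ≤v z≤M =
  subst (∣ riemann (suc a) u - riemann (suc a) v ∣ ≤_) total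
    (sumℚ-diff (suc a) {b = w * s * (1ℚ + M * r)} term)
  where
  y = u - 1ℚ
  z = v - 1ℚ
  w = ∣ u - v ∣
  r = recip δ
  A = ℕ→ℚ (suc a)
  s = recip A * r
  0≤r : 0ℚ ≤ r
  0≤r = <⇒≤ (recip-pos 0<δ)
  0≤s : 0ℚ ≤ s
  0≤s = 0≤* (<⇒≤ (recip-pos (0<ℕ→ℚ a))) 0≤r
  0≤M : 0ℚ ≤ M
  0≤M = ≤-trans (0≤∣p∣ z) z≤M
  As≡r : A * s ≡ r
  As≡r = trans (sym (*-assoc A (recip A) r)) (trans (cong (_* r) (*-recip (0<ℕ→ℚ a))) (*-identityˡ r))
  total : A * (w * s * (1ℚ + M * r)) ≡ (r * (1ℚ + M * r)) * w
  total = trans (solve 4 (λ A w s k → A :* (w :* s :* k) := (A :* s :* k) :* w) refl A w s (1ℚ + M * r))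
    (cong (λ t → (t * (1ℚ + M * r)) * w) As≡r)
  1+-1 : ∀ t → 1ℚ + (t - 1ℚ) ≡ t
  1+-1 t = solve 1 (λ t → con 1ℚ :+ (t :- con 1ℚ) := t) refl t
  term : ∀ i → i ℕ.< suc a → ∣ y * recip (A + ℕ→ℚ i * y) - z * recip (A + ℕ→ℚ i * z) ∣ ≤ w * s * (1ℚ + M * r)
  term i i<a = ≤-trans
    (subst (λ t → ∣ t ∣ ≤ ∣ (y - z) * recip P ∣ + ∣ z * (recip P - recip Q) ∣)
      (solve 4 (λ y z p q → (y :- z) :* p :+ z :* (p :- q) := y :* p :- z :* q) refl y z (recip P) (recip Q))
      (∣p+q∣≤∣p∣+∣q∣ ((y - z) * recip P) (z * (recip P - recip Q))))
    (≤-trans (subst₂ _≤_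
        (cong₂ _+_
          (trans (cong₂ _*_ (cong ∣_∣ y-z) (sym (0≤p⇒∣p∣≡p 0≤rP))) (sym (∣p*q∣≡∣p∣*∣q∣ (y - z) (recip P))))
          (sym (∣p*q∣≡∣p∣*∣q∣ z (recip P - recip Q))))
        refl
        (+-mono-≤ (*-mono-≤-nonNeg (0≤∣p∣ (u - v)) ≤-refl 0≤rP (proj₂ nP))
                  (*-mono-≤-nonNeg (0≤∣p∣ z) z≤M (0≤∣p∣ (recip P - recip Q)) rdiff)))
      (≤-reflexive (trans
        (solve 5 (λ w s M A r → w :* s :+ M :* (A :* w :* (s :* s)) := w :* s :+ M :* (A :* s) :* w :* s)
          refl w s M A r)
        (trans (cong (λ t → w * s + M * t * w * s) As≡r)
          (solve 4 (λ w s M r → w :* s :+ M :* r :* w :* s := w :* s :* (con 1ℚ :+ M :* r)) refl w s M r)))))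
    where
    i≤a = ℕ.<⇒≤ i<a
    I = ℕ→ℚ i
    P = A + I * y
    Q = A + I * z
    nP = node-recip a 0<δ (node-bound {y = y} (suc a) i 0<δ δ≤1 (subst (δ ≤_) (sym (1+-1 u)) δ≤u) i≤a)
    nQ = node-recip a 0<δ (node-bound {y = z} (suc a) i 0<δ δ≤1 (subst (δ ≤_) (sym (1+-1 v)) δ≤v) i≤a)
    0≤rP : 0ℚ ≤ recip P
    0≤rP = <⇒≤ (recip-pos (proj₁ nP))
    y-z : u - v ≡ y - z
    y-z = solve 2 (λ u v → u :- v := (u :- con 1ℚ) :- (v :- con 1ℚ)) refl u v
    P-Q : ∣ P - Q ∣ ≡ I * w
    P-Q = trans (cong ∣_∣ (solve 4 (λ A I u v → (A :+ I :* (u :- con 1ℚ)) :- (A :+ I :* (v :- con 1ℚ)) := I :* (u :- v)) refl A I u v))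
      (trans (∣p*q∣≡∣p∣*∣q∣ I (u - v)) (cong (_* w) (0≤p⇒∣p∣≡p (0≤ℕ→ℚ i))))
    rdiff : ∣ recip P - recip Q ∣ ≤ A * w * (s * s)
    rdiff = ≤-trans (recip-diff (proj₁ nP) (proj₁ nQ) (proj₂ nP) (proj₂ nQ))
      (*-monoʳ-≤-nonNeg (s * s) {{nonNegative (0≤* 0≤s 0≤s)}}
        (subst (_≤ A * w) (sym P-Q)
          (*-monoʳ-≤-nonNeg w {{nonNegative (0≤∣p∣ (u - v))}} (ℕ→ℚ-mono {i} {suc a} i≤a))))

riemann-refine : ∀ {δ M u} a b → 0ℚ < δ → δ ≤ 1ℚ → δ ≤ u → ∣ u - 1ℚ ∣ ≤ M →
  ∣ riemann (suc a) u - riemann (suc a ℕ.* suc b) u ∣ ≤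
    (M * recip δ) * (M * recip δ) * recip (ℕ→ℚ (suc a))
riemann-refine {δ} {M} {u} a b 0<δ δ≤1 δ≤u y≤M =
  subst₂ _≤_ (cong₂ (λ p q → ∣ p - q ∣) (sym lhs) (sym (sumℚ-blocks (suc a) (suc b) f))) total
    (sumℚ-diff (suc a) λ i i<a → sumℚ-diff (suc b) λ j j<b → term i j i<a j<b)
  where
  y = u - 1ℚ
  r = recip δ
  A = ℕ→ℚ (suc a)
  B = ℕ→ℚ (suc b)
  c = b ℕ.+ a ℕ.* suc b
  AB = ℕ→ℚ (suc c)
  s = recip AB * r
  AB≡ : AB ≡ A * B
  AB≡ = ℕ→ℚ-* (suc a) (suc b)
  0<A = 0<ℕ→ℚ a
  0<B = 0<ℕ→ℚ b
  0<AB = 0<ℕ→ℚ c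
  0≤r : 0ℚ ≤ r
  0≤r = <⇒≤ (recip-pos 0<δ)
  0≤s : 0ℚ ≤ s
  0≤s = 0≤* (<⇒≤ (recip-pos 0<AB)) 0≤r
  0≤M : 0ℚ ≤ M
  0≤M = ≤-trans (0≤∣p∣ y) y≤M
  δ≤1+y : δ ≤ 1ℚ + y
  δ≤1+y = subst (δ ≤_) (sym (solve 1 (λ t → con 1ℚ :+ (t :- con 1ℚ) := t) refl u)) δ≤u
  f : ℕ → ℚ
  f k = y * recip (AB + ℕ→ℚ k * y)
  bound : ℚ
  bound = M * (B * M * (s * s))
  node : ℕ → ℚ
  node i = A + ℕ→ℚ i * y
  B*node : ∀ i → B * node i ≡ AB + ℕ→ℚ (i ℕ.* suc b) * y
  B*node i = trans (solve 4 (λ A B I y → B :* (A :+ I :* y) := A :* B :+ I :* B :* y) refl A B (ℕ→ℚ i) y)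
    (cong₂ (λ p q → p + q * y) (sym AB≡) (sym (ℕ→ℚ-* i (suc b))))
  recip-B : ∀ q → 0ℚ < q → B * (y * recip (B * q)) ≡ y * recip q
  recip-B q 0<q = begin
    B * (y * t)                   ≡⟨ sym (*-identityʳ _) ⟩
    B * (y * t) * 1ℚ              ≡⟨ cong (B * (y * t) *_) (sym (*-recip 0<q)) ⟩
    B * (y * t) * (q * recip q)   ≡⟨ solve 5 (λ B y t q w → B :* (y :* t) :* (q :* w) := (B :* q :* t) :* (y :* w)) refl B y t q (recip q) ⟩
    (B * q * t) * (y * recip q)   ≡⟨ cong (_* (y * recip q)) (*-recip (0<* 0<B 0<q)) ⟩
    1ℚ * (y * recip q)            ≡⟨ *-identityˡ _ ⟩
    y * recip q                   ∎
    where
    open ≡-Reasoning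
    t = recip (B * q)
  lhs : riemann (suc a) u ≡ sumℚ (suc a) (λ i → sumℚ (suc b) (λ _ → y * recip (B * node i)))
  lhs = sumℚ-cong (suc a) λ i i<a → trans
    (sym (recip-B (node i) (proj₁ (node-recip a 0<δ (node-bound {y = y} (suc a) i 0<δ δ≤1 δ≤1+y (ℕ.<⇒≤ i<a))))))
    (sym (sumℚ-const (suc b) (y * recip (B * node i))))
  one₁ : A * B * recip AB ≡ 1ℚ
  one₁ = trans (cong (_* recip AB) (sym AB≡)) (*-recip 0<AB)
  B*recip : B * recip AB ≡ recip A
  B*recip = begin
    B * recip AB                    ≡⟨ sym (*-identityˡ _) ⟩
    1ℚ * (B * recip AB)             ≡⟨ cong (_* (B * recip AB)) (sym (*-recip 0<A)) ⟩
    A * recip A * (B * recip AB)    ≡⟨ solve 4 (λ A t B w → A :* t :* (B :* w) := A :* B :* w :* t) refl A (recip A) B (recip AB) ⟩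
    A * B * recip AB * recip A      ≡⟨ cong (_* recip A) one₁ ⟩
    1ℚ * recip A                    ≡⟨ *-identityˡ _ ⟩
    recip A                         ∎
    where open ≡-Reasoning
  total : A * (B * bound) ≡ (M * r) * (M * r) * recip A
  total = begin
    A * (B * bound)
      ≡⟨ solve 5 (λ A B M t r → A :* (B :* (M :* (B :* M :* (t :* r :* (t :* r))))) := (A :* B :* t) :* ((M :* r) :* (M :* r) :* (B :* t))) refl A B M (recip AB) r ⟩
    (A * B * recip AB) * ((M * r) * (M * r) * (B * recip AB))
      ≡⟨ cong₂ (λ p q → p * ((M * r) * (M * r) * q)) one₁ B*recip ⟩
    1ℚ * ((M * r) * (M * r) * recip A)
      ≡⟨ *-identityˡ _ ⟩
    (M * r) * (M * r) * recip A ∎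
    where open ≡-Reasoning
  term : ∀ i j → i ℕ.< suc a → j ℕ.< suc b →
         ∣ y * recip (B * node i) - f (i ℕ.* suc b ℕ.+ j) ∣ ≤ bound
  term i j i<a j<b = subst (_≤ bound)
    (trans (sym (∣p*q∣≡∣p∣*∣q∣ y (recip P - recip Q)))
      (cong ∣_∣ (solve 3 (λ y p q → y :* (p :- q) := y :* p :- y :* q) refl y (recip P) (recip Q))))
    (*-mono-≤-nonNeg (0≤∣p∣ y) y≤M (0≤∣p∣ (recip P - recip Q)) rdiff)
    where
    k = i ℕ.* suc b ℕ.+ j
    P = B * node i
    Q = AB + ℕ→ℚ k * y
    k≤c : k ℕ.≤ suc c
    k≤c = ℕ.≤-trans (ℕ.+-monoʳ-≤ (i ℕ.* suc b) (ℕ.<⇒≤ j<b))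
      (ℕ.≤-trans (ℕ.≤-reflexive (ℕ.+-comm (i ℕ.* suc b) (suc b))) (ℕ.*-monoˡ-≤ (suc b) i<a))
    ib≤c : i ℕ.* suc b ℕ.≤ suc c
    ib≤c = ℕ.≤-trans (ℕ.m≤m+n (i ℕ.* suc b) j) k≤c
    nP = node-recip {q = P} c 0<δ (subst (AB * δ ≤_) (sym (B*node i))
      (node-bound {y = y} (suc c) (i ℕ.* suc b) 0<δ δ≤1 δ≤1+y ib≤c))
    nQ = node-recip {q = Q} c 0<δ (node-bound {y = y} (suc c) k 0<δ δ≤1 δ≤1+y k≤c)
    J = ℕ→ℚ j
    Q-P : Q - P ≡ J * y
    Q-P = trans (cong₂ (λ p q → AB + p * y - q) (ℕ→ℚ-+ (i ℕ.* suc b) j) (B*node i))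
      (solve 4 (λ X I J y → (X :+ (I :+ J) :* y) :- (X :+ I :* y) := J :* y) refl AB (ℕ→ℚ (i ℕ.* suc b)) J y)
    P-Q : ∣ P - Q ∣ ≤ B * M
    P-Q = subst (_≤ B * M)
      (trans (cong (_* ∣ y ∣) (sym (0≤p⇒∣p∣≡p (0≤ℕ→ℚ j))))
        (trans (sym (∣p*q∣≡∣p∣*∣q∣ J y)) (trans (cong ∣_∣ (sym Q-P)) (∣-∣-swap Q P))))
      (*-mono-≤-nonNeg (0≤ℕ→ℚ j) (ℕ→ℚ-mono {j} {suc b} (ℕ.<⇒≤ j<b)) (0≤∣p∣ y) y≤M)
    rdiff : ∣ recip P - recip Q ∣ ≤ B * M * (s * s)
    rdiff = ≤-trans (recip-diff (proj₁ nP) (proj₁ nQ) (proj₂ nP) (proj₂ nQ))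
      (*-monoʳ-≤-nonNeg (s * s) {{nonNegative (0≤* 0≤s 0≤s)}} P-Q)

-- The diagonal of approximants S a (seq x a) is Cauchy when S is uniformly
-- Lipschitz in its second argument and stable under refinement of the first.
diagonal-cauchy : (S : ℕ → ℚ → ℚ) (x : ℝ) (k₁ k₂ : ℚ) → 0ℚ < k₁ → 0ℚ < k₂ → (N₀ : ℕ) →
  (∀ a b n → N₀ ℕ.≤ n → ∣ S (suc a) (seq x n) - S (suc a ℕ.* suc b) (seq x n) ∣ ≤ k₁ * recip (ℕ→ℚ (suc a))) →
  (∀ a m n → N₀ ℕ.≤ m → N₀ ℕ.≤ n → ∣ S (suc a) (seq x m) - S (suc a) (seq x n) ∣ ≤ k₂ * ∣ seq x m - seq x n ∣) →
  IsCauchy (λ n → S (suc n) (seq x n))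
diagonal-cauchy S x k₁ k₂ 0<k₁ 0<k₂ N₀ refine lipschitz =
  cauchy-by (λ n → S (suc n) (seq x n)) (k₁ + k₂ + k₁) (+-mono-< (+-mono-< 0<k₁ 0<k₂) 0<k₁) λ ε 0<ε →
    let N₁ , arch = archimedean ε 0<ε
        N₂ , close = cauchy x ε 0<ε
        fine : ∀ a b → N₀ ℕ.≤ a → N₁ ℕ.≤ a →
               ∣ S (suc a) (seq x a) - S (suc a ℕ.* suc b) (seq x a) ∣ ≤ k₁ * ε
        fine a b h₀ h₁ = ≤-trans (refine a b a h₀)
          (*-monoˡ-≤-nonNeg k₁ {{nonNegative (<⇒≤ 0<k₁)}} (arch a h₁))
    in N₀ ℕ.⊔ (N₁ ℕ.⊔ N₂) , λ m n ≤m ≤n →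
      let m₀ = ℕ.m⊔n≤o⇒m≤o N₀ (N₁ ℕ.⊔ N₂) ≤m
          n₀ = ℕ.m⊔n≤o⇒m≤o N₀ (N₁ ℕ.⊔ N₂) ≤n
          m₁₂ = ℕ.m⊔n≤o⇒n≤o N₀ (N₁ ℕ.⊔ N₂) ≤m
          n₁₂ = ℕ.m⊔n≤o⇒n≤o N₀ (N₁ ℕ.⊔ N₂) ≤n
          p₁ = S (suc m) (seq x m)
          p₂ = S (suc m ℕ.* suc n) (seq x m)
          p₃ = S (suc m ℕ.* suc n) (seq x n)
          p₄ = S (suc n) (seq x n)
          first = fine m n m₀ (ℕ.m⊔n≤o⇒m≤o N₁ N₂ m₁₂)
          middle = ≤-trans (lipschitz (n ℕ.+ m ℕ.* suc n) m n m₀ n₀)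
            (*-monoˡ-≤-nonNeg k₂ {{nonNegative (<⇒≤ 0<k₂)}}
              (close m n (ℕ.m⊔n≤o⇒n≤o N₁ N₂ m₁₂) (ℕ.m⊔n≤o⇒n≤o N₁ N₂ n₁₂)))
          last = subst (_≤ k₁ * ε)
            (trans (∣-∣-swap p₄ (S (suc n ℕ.* suc m) (seq x n)))
              (cong (λ k → ∣ S k (seq x n) - p₄ ∣) (ℕ.*-comm (suc n) (suc m))))
            (fine n m n₀ (ℕ.m⊔n≤o⇒m≤o N₁ N₂ n₁₂))
      in subst (∣ p₁ - p₄ ∣ ≤_)
        (solve 3 (λ a b e → a :* e :+ b :* e :+ a :* e := (a :+ b :+ a) :* e) refl k₁ k₂ ε)
        (≤-trans (∣-∣-triangle p₁ p₃ p₄)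
          (+-mono-≤ (≤-trans (∣-∣-triangle p₁ p₂ p₃) (+-mono-≤ first middle)) last))

log-cauchy : ∀ x → 0ℝ <ℝ x → IsCauchy (λ n → riemann (suc n) (seq x n))
log-cauchy x 0<x = diagonal-cauchy riemann x
  ((M * r) * (M * r)) (r * (1ℚ + M * r))
  (0<* (0<* 0<M 0<r) (0<* 0<M 0<r)) (0<* 0<r (+-mono-< 0<1 (0<* 0<M 0<r)))
  (N₁ ℕ.⊔ N₂)
  (λ a b n ≤n → riemann-refine a b 0<δ δ≤1 (δ≤ n ≤n) (≤M n ≤n))
  (λ a m n ≤m ≤n → riemann-lipschitz a 0<δ δ≤1 (δ≤ m ≤m) (δ≤ n ≤n) (≤M n ≤n))
  where
  below = bounded-below {x} 0<x
  above = bounded x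
  δ₀ = proj₁ below
  B = proj₁ above
  N₁ = proj₁ (proj₂ (proj₂ below))
  N₂ = proj₁ (proj₂ (proj₂ above))
  shrink : ∀ d → 0ℚ < d → ∃ λ δ → 0ℚ < δ × δ ≤ 1ℚ × δ ≤ d
  shrink d 0<d with ≤-total d 1ℚ
  ... | inj₁ d≤1 = d , 0<d , d≤1 , ≤-refl
  ... | inj₂ 1≤d = 1ℚ , 0<1 , ≤-refl , 1≤d
  shrunk = shrink δ₀ (proj₁ (proj₂ below))
  δ = proj₁ shrunk
  0<δ = proj₁ (proj₂ shrunk)
  δ≤1 = proj₁ (proj₂ (proj₂ shrunk))
  r M : ℚ
  r = recip δ
  M = B + 1ℚ
  0<r : 0ℚ < r
  0<r = recip-pos 0<δ
  0<M : 0ℚ < M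
  0<M = +-mono-< (proj₁ (proj₂ above)) 0<1
  δ≤ : ∀ k → N₁ ℕ.⊔ N₂ ℕ.≤ k → δ ≤ seq x k
  δ≤ k h = ≤-trans (proj₂ (proj₂ (proj₂ shrunk))) (proj₂ (proj₂ (proj₂ below)) k (ℕ.m⊔n≤o⇒m≤o N₁ N₂ h))
  ≤M : ∀ k → N₁ ℕ.⊔ N₂ ℕ.≤ k → ∣ seq x k - 1ℚ ∣ ≤ M
  ≤M k h = ≤-trans (∣p-q∣≤∣p∣+∣q∣ (seq x k) 1ℚ)
    (+-monoˡ-≤ 1ℚ (proj₂ (proj₂ (proj₂ above)) k (ℕ.m⊔n≤o⇒n≤o N₁ N₂ h)))

-- log x = ∫₁ˣ dt/t.
log : ∀ x → 0ℝ <ℝ x → ℝ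
log x 0<x = mkℝ (λ n → riemann (suc n) (seq x n)) (log-cauchy x 0<x)

-- Weighted outcomes; an outcome may be listed more than once.
Dist : Set → Set
Dist A = List (ℝ × A)

return : ∀ {A} → A → Dist A
return a = (1ℝ , a) ∷ []

infixl 1 _>>=_

_>>=_ : ∀ {A B} → Dist A → (A → Dist B) → Dist B
d >>= f = concatMap (λ (w , a) → map (map₁ (w *ℝ_)) (f a)) d

Pr : ∀ {A} → Dist A → (A → Bool) → ℝ
Pr []            E = 0ℝ
Pr ((w , a) ∷ d) E = (if E a then w else 0ℝ) +ℝ Pr d E

iid : ∀ {A} → Dist A → ∀ n → Dist (Vec A n)
iid d zero    = return []
iid d (suc n) = d >>= λ a → iid d n >>= λ as → return (a ∷ as)

-- Families indexed by the 2-element subsets of Fin n: in  row ∷ rest  the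
-- entry of {zero , suc j} is  lookup row j,  and  rest  holds the pairs
-- {suc i , suc j}.
data Pairs (A : Set) : ℕ → Set where
  []  : Pairs A 0
  _∷_ : ∀ {n} → Vec A n → Pairs A n → Pairs A (suc n)

mapPairs : ∀ {A B n} → (A → B) → Pairs A n → Pairs B n
mapPairs f []           = []
mapPairs f (row ∷ rest) = Vec.map f row ∷ mapPairs f rest

iidPairs : ∀ {A} → Dist A → ∀ n → Dist (Pairs A n)
iidPairs d zero    = return []
iidPairs d (suc n) = iid d n >>= λ row → iidPairs d n >>= λ rest → return (row ∷ rest)

Graph : ℕ → Set
Graph = Pairs Bool

adjacent : ∀ {n} → Graph n → Fin n → Fin n → Bool
adjacent (row ∷ rest) zero    zero    = false
adjacent (row ∷ rest) zero    (suc j) = lookup row j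
adjacent (row ∷ rest) (suc i) zero    = lookup row i
adjacent (row ∷ rest) (suc i) (suc j) = adjacent rest i j

module _ (p q : ℝ) (0<p : 0ℝ <ℝ p) (0<q : 0ℝ <ℝ q) where

  stationaryDensity : ℝ
  stationaryDensity = p /ℝ (p +ℝ q) [ +ℝ-pos {p} {q} 0<p 0<q ]

  stationaryDensity-pos : 0ℝ <ℝ stationaryDensity
  stationaryDensity-pos = /ℝ-pos {p} {p +ℝ q} 0<p (+ℝ-pos {p} {q} 0<p 0<q)

  stationary : Dist Bool
  stationary = (1ℝ -ℝ stationaryDensity , false) ∷ (stationaryDensity , true) ∷ []

  step : Bool → Dist Bool
  step false = (1ℝ -ℝ p , false) ∷ (p , true) ∷ []
  step true  = (q , false) ∷ (1ℝ -ℝ q , true) ∷ []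

  pathFrom : Bool → ∀ h → Dist (Vec Bool (suc h))
  pathFrom x zero    = return (x ∷ [])
  pathFrom x (suc h) = step x >>= λ y → pathFrom y h >>= λ ys → return (x ∷ ys)

  -- The joint law of X₀(e), …, X_h(e) over all pairs e.
  edgeMEG : ∀ n h → Dist (Pairs (Vec Bool (suc h)) n)
  edgeMEG n h = iidPairs (stationary >>= λ x → pathFrom x h) n

-- A realisation of all the chains, X(e) : t ↦ X_t(e).
Trajectory : ℕ → Set
Trajectory = Pairs (ℕ → Bool)

prefix : ∀ {n} h → Trajectory n → Pairs (Vec Bool (suc h)) n
prefix h = mapPairs (λ x → tabulate (λ t → x (toℕ t)))

-- For a property A of trajectories that is decided by finitely many time
-- steps: A holds with probability at least r. As A need not be decidable (it
-- may compare real numbers), the bound is witnessed by a decidable event E in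
-- the first h + 1 steps that implies A.
WithProbability≥ : ∀ p q → 0ℝ <ℝ p → 0ℝ <ℝ q → ∀ n → ℝ → (Trajectory n → Set) → Set
WithProbability≥ p q 0<p 0<q n r A =
  ∃ λ h → Σ (Pairs (Vec Bool (suc h)) n → Bool) λ E →
    (∀ X → E (prefix h X) ≡ true → A X) × r ≤ℝ Pr (edgeMEG p q 0<p 0<q n h) E

graphAt : ∀ {n} → Trajectory n → ℕ → Graph n
graphAt X t = mapPairs (λ x → x t) X

neighbours : ∀ {n} → Graph n → Subset n → Subset n
neighbours G I = tabulate λ v →
  does (¬? (v ∈? I) ×-dec any? (λ u → (u ∈? I) ×-dec (adjacent G u v Bool.≟ true)))

informed : ∀ {n} → Trajectory n → Fin n → ℕ → Subset n
informed X s zero    = ⁅ s ⁆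
informed X s (suc t) = informed X s t ∪ neighbours (graphAt X t) (informed X s t)

-- T(s) = t.
IsCompletionTime : ∀ {n} → Trajectory n → Fin n → ℕ → Set
IsCompletionTime X s t = informed X s t ≡ ⊤ × (∀ t′ → t′ ℕ.< t → informed X s t′ ≢ ⊤)

-- max_s T(s) = T.
IsFloodingTime : ∀ {n} → Trajectory n → ℕ → Set
IsFloodingTime X T =
  (∀ s → ∃ λ t → IsCompletionTime X s t × t ℕ.≤ T) × ∃ λ s → IsCompletionTime X s T

-- If some T(s) is infinite then so is the flooding time, and the bound holds.
FloodingTime≥ : ∀ {n} → ℝ → Trajectory n → Set
FloodingTime≥ x X = ∀ T → IsFloodingTime X T → x ≤ℝ fromℕ T

{-# OPTIONS --safe #-}
module Submission where

-- Every G_t has law G_{n,p̂}, so E[2^deg] = (1 + p̂)^(n-1), and a union bound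
-- over n nodes and n times shows that, with probability at least 1 - 1/n, all
-- degrees stay below some D = O(n p̂ + log n) = O(n p̂). Then |I_t| ≤ D^t, hence
-- n ≤ D^T for the flooding time T, that is, T ≥ log n / log D. All weights and
-- logarithms are estimated at a fixed index of the Cauchy sequences, where the
-- chains are exact two-state chains with rational weights. The only analytic
-- input is the inequality between arithmetic and geometric means: applied to
-- the ratios of consecutive nodes of a Riemann sum, and to copies of 2 or 1/2,
-- it compares the logarithm with the binary logarithm.

open import Defs
open import Data.Nat using (ℕ; NonZero; _≤_)
open import Data.Product using (Σ; ∃; _×_)

open import Algebra.Bundles using (CommutativeRing)
open import Data.Bool using (Bool; true; false; if_then_else_; not; _∨_)
import Data.Bool.Properties as Bool
open import Data.Empty using (⊥-elim)
open import Data.Fin as Fin using (Fin; zero; suc; toℕ)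
open import Data.Fin.Properties using (any?; toℕ-fromℕ<)
open import Data.Fin.Subset using (Subset; _∪_) renaming (∣_∣ to card)
open import Data.Fin.Subset.Properties using (_∈?_; ∣⁅x⁆∣≡1; ∣⊤∣≡n)
open import Data.List using ([]; _∷_; map; _++_)
open import Data.Nat as ℕ using (zero; suc; s≤s; z≤n)
import Data.Nat.Properties as ℕ
open import Data.Nat.Tactic.RingSolver using (solve-∀)
open import Data.Product using (_,_; proj₁; proj₂; map₁)
open import Data.Rational using (ℚ; 0ℚ; 1ℚ; ½; _+_; _*_; _-_; -_; ∣_∣; nonNegative; positive) renaming (_≤_ to _≤ℚ_; _<_ to _<ℚ_)
import Data.Rational.Properties as ℚ
open import Data.Rational.Solver using (module +-*-Solver)
open import Data.Sum using (inj₁; inj₂)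
open import Data.Vec as Vec using (Vec; []; _∷_; lookup; tabulate)
open import Data.Vec.Properties using (tabulate∘lookup; lookup-map; lookup∘tabulate; lookup-zipWith; []=⇒lookup; map-∘; map-cong)
open import Function using (_∘_)
open import Relation.Binary.PropositionalEquality using (_≡_; refl; sym; trans; cong; cong₂; subst; subst₂; module ≡-Reasoning)
open import Relation.Nullary using (¬_; Dec; does; yes; no; ¬?; _×-dec_)

open import Algebra.Properties.CommutativeMonoid.Sum ℕ.+-0-commutativeMonoid using (sum; sum-cong-≗; ∑-comm; ∑-distrib-+)
open import Algebra.Properties.Semiring.Sum ℕ.+-*-semiring using (*-distribˡ-sum)
open import Algebra.Properties.Semiring.Exp (CommutativeRing.semiring ℚ.+-*-commutativeRing) using (_^_; ^-homo-*)
open +-*-Solver using (solve; _:=_; con; _:+_; _:*_; _:-_)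

-- Rational arithmetic and the AM-GM inequality

-- Real numbers are Cauchy sequences without a decidable order, while the event that witnesses a
-- probability must be decidable. The degree bound D is therefore a natural number fixed in advance
-- from `n p̂`, and inequalities between reals are proved between their k-th terms for all large k,
-- which implies `_≤ℝ_`. This is also why AM-GM suits the logarithm: the k-th term of `log x` is one
-- finite Riemann sum at one rational point, and AM-GM bounds it as it stands, with no passage to a
-- limit. Base 2 keeps the moment of the degree and the scales that bracket `n p̂` rational. The
-- price lies in the constants only: comparing the natural with the binary logarithm loses a factor
-- 2 in each direction.

2ℚ : ℚ
2ℚ = ℕ→ℚ 2

0≤1 : 0ℚ ≤ℚ 1ℚ
0≤1 = ℚ.<⇒≤ 0<1

0≤½ : 0ℚ ≤ℚ ½
0≤½ = ℚ.nonNegative⁻¹ ½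

*-monoˡ : ∀ {a b c} → 0ℚ ≤ℚ a → b ≤ℚ c → a * b ≤ℚ a * c
*-monoˡ {a} 0≤a b≤c = ℚ.*-monoˡ-≤-nonNeg a {{nonNegative 0≤a}} b≤c

*-monoʳ : ∀ {a b c} → 0ℚ ≤ℚ a → b ≤ℚ c → b * a ≤ℚ c * a
*-monoʳ {a} 0≤a b≤c = ℚ.*-monoʳ-≤-nonNeg a {{nonNegative 0≤a}} b≤c

*-cancelˡ : ∀ {a b c} → 0ℚ <ℚ a → a * b ≤ℚ a * c → b ≤ℚ c
*-cancelˡ {a} 0<a = ℚ.*-cancelˡ-≤-pos a {{positive 0<a}}

0≤square : ∀ x → 0ℚ ≤ℚ x * x
0≤square x with ℚ.≤-total 0ℚ x
... | inj₁ 0≤x = 0≤* 0≤x 0≤x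
... | inj₂ x≤0 = subst (0ℚ ≤ℚ_) (solve 1 (λ x → (con 0ℚ :- x) :* (con 0ℚ :- x) := x :* x) refl x)
                   (0≤* 0≤-x 0≤-x)
  where
  0≤-x : 0ℚ ≤ℚ 0ℚ - x
  0≤-x = subst (_≤ℚ 0ℚ - x) (ℚ.+-inverseʳ x) (ℚ.+-monoˡ-≤ (- x) x≤0)

ℕ→ℚ-suc : ∀ n → ℕ→ℚ (suc n) ≡ 1ℚ + ℕ→ℚ n
ℕ→ℚ-suc = ℕ→ℚ-+ 1

ℕ→ℚ-cancel-≤ : ∀ {m n} → ℕ→ℚ m ≤ℚ ℕ→ℚ n → m ≤ n
ℕ→ℚ-cancel-≤ {m} {n} h with m ℕ.≤? n
... | yes m≤n = m≤n
... | no  m≰n = ⊥-elim (ℚ.<-irrefl refl (ℚ.<-≤-trans n<1+n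
      (ℚ.≤-trans (ℕ→ℚ-mono (ℕ.≰⇒> m≰n)) h)))
  where
  n<1+n : ℕ→ℚ n <ℚ ℕ→ℚ (suc n)
  n<1+n = subst₂ _<ℚ_ (ℚ.+-identityˡ (ℕ→ℚ n)) (sym (ℕ→ℚ-suc n)) (ℚ.+-monoˡ-< (ℕ→ℚ n) 0<1)

ℕ→ℚ-^ : ∀ m k → ℕ→ℚ (m ℕ.^ k) ≡ ℕ→ℚ m ^ k
ℕ→ℚ-^ m zero    = refl
ℕ→ℚ-^ m (suc k) = trans (ℕ→ℚ-* m (m ℕ.^ k)) (cong (ℕ→ℚ m *_) (ℕ→ℚ-^ m k))

0≤^ : ∀ {x} n → 0ℚ ≤ℚ x → 0ℚ ≤ℚ x ^ n
0≤^ zero    0≤x = 0≤1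
0≤^ (suc n) 0≤x = 0≤* 0≤x (0≤^ n 0≤x)

^-≤1 : ∀ {x} n → 0ℚ ≤ℚ x → x ≤ℚ 1ℚ → x ^ n ≤ℚ 1ℚ
^-≤1 zero    0≤x x≤1 = ℚ.≤-refl
^-≤1 (suc n) 0≤x x≤1 = *-mono-≤-nonNeg 0≤x x≤1 (0≤^ n 0≤x) (^-≤1 n 0≤x x≤1)

^-inverse : ∀ {x y} n → x * y ≡ 1ℚ → x ^ n * y ^ n ≡ 1ℚ
^-inverse zero    xy≡1 = refl
^-inverse {x} {y} (suc n) xy≡1 = trans
  (solve 4 (λ x y u v → (x :* u) :* (y :* v) := (x :* y) :* (u :* v)) refl x y (x ^ n) (y ^ n))
  (cong₂ _*_ xy≡1 (^-inverse n xy≡1))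

-- The convex function Bᴺ⁺¹ lies above its tangent at A.
tangent-≤-power : ∀ N {A B} → 0ℚ ≤ℚ A → 0ℚ ≤ℚ B →
                  A ^ N * (ℕ→ℚ (suc N) * B - ℕ→ℚ N * A) ≤ℚ B ^ suc N
tangent-≤-power zero {A} {B} 0≤A 0≤B = ℚ.≤-reflexive
  (solve 2 (λ A B → con 1ℚ :* (con 1ℚ :* B :- con 0ℚ :* A) := B :* con 1ℚ) refl A B)
tangent-≤-power (suc N) {A} {B} 0≤A 0≤B = begin
  A * A ^ N * (ℕ→ℚ (suc (suc N)) * B - ℕ→ℚ (suc N) * A)
    ≡⟨ cong (λ w → A * A ^ N * (w * B - ℕ→ℚ (suc N) * A)) (ℕ→ℚ-suc (suc N)) ⟩
  A * A ^ N * ((1ℚ + ℕ→ℚ (suc N)) * B - ℕ→ℚ (suc N) * A)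
    ≡⟨ cong (λ w → A * A ^ N * ((1ℚ + w) * B - w * A)) (ℕ→ℚ-suc N) ⟩
  A * A ^ N * ((1ℚ + (1ℚ + n)) * B - (1ℚ + n) * A)
    ≡⟨ sym (ℚ.+-identityʳ _) ⟩
  A * A ^ N * ((1ℚ + (1ℚ + n)) * B - (1ℚ + n) * A) + 0ℚ
    -- The added term is the exact slack of the induction step: B times the tangent value for
    -- exponent N + 1, minus the tangent value for exponent N + 2, equals `A ^ N` (N + 1) (B - A)².
    ≤⟨ ℚ.+-monoʳ-≤ (A * A ^ N * ((1ℚ + (1ℚ + n)) * B - (1ℚ + n) * A))
         (0≤* (0≤^ N 0≤A) (0≤* (0≤+ 0≤1 (0≤ℕ→ℚ N)) (0≤square (B - A)))) ⟩
  A * A ^ N * ((1ℚ + (1ℚ + n)) * B - (1ℚ + n) * A) + A ^ N * ((1ℚ + n) * ((B - A) * (B - A)))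
    ≡⟨ solve 4 (λ A B n P →
         A :* P :* ((con 1ℚ :+ (con 1ℚ :+ n)) :* B :- (con 1ℚ :+ n) :* A) :+ P :* ((con 1ℚ :+ n) :* ((B :- A) :* (B :- A)))
           := B :* (P :* ((con 1ℚ :+ n) :* B :- n :* A))) refl A B n (A ^ N) ⟩
  B * (A ^ N * ((1ℚ + n) * B - n * A))
    ≡⟨ cong (λ w → B * (A ^ N * (w * B - n * A))) (sym (ℕ→ℚ-suc N)) ⟩
  B * (A ^ N * (ℕ→ℚ (suc N) * B - n * A))
    ≤⟨ *-monoˡ 0≤B (tangent-≤-power N 0≤A 0≤B) ⟩
  B * B ^ suc N ∎
  where
  open ℚ.≤-Reasoning
  n = ℕ→ℚ N

-- The AM-GM inequality for N numbers with sum S and product P, as an invariant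
-- preserved by adjoining a number.
record AMGM (N : ℕ) (S P : ℚ) : Set where
  constructor mkAMGM
  field
    mean      : ℚ
    0≤mean    : 0ℚ ≤ℚ mean
    S≡N*mean  : S ≡ ℕ→ℚ N * mean
    P≤mean^N  : P ≤ℚ mean ^ N

amgm-empty : AMGM 0 0ℚ 1ℚ
amgm-empty = mkAMGM 0ℚ ℚ.≤-refl refl ℚ.≤-refl

-- If A is the old mean and B the new one, then x = (N + 1) B - N A, so `A ^ N * x` is exactly the
-- left side of `tangent-≤-power`.
amgm-snoc : ∀ {N S P x} → 0ℚ ≤ℚ x → AMGM N S P → AMGM (suc N) (S + x) (P * x)
amgm-snoc {N} {S} {P} {x} 0≤x (mkAMGM A 0≤A S≡ P≤) = mkAMGM B 0≤B S+x≡ (begin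
  P * x                      ≤⟨ *-monoʳ 0≤x P≤ ⟩
  A ^ N * x                  ≡⟨ cong (A ^ N *_) x≡ ⟩
  A ^ N * (ℕ→ℚ (suc N) * B - ℕ→ℚ N * A)  ≤⟨ tangent-≤-power N 0≤A 0≤B ⟩
  B ^ suc N ∎)
  where
  open ℚ.≤-Reasoning
  B : ℚ
  B = (S + x) * recip (ℕ→ℚ (suc N))
  0≤B : 0ℚ ≤ℚ B
  0≤B = 0≤* (0≤+ (subst (0ℚ ≤ℚ_) (sym S≡) (0≤* (0≤ℕ→ℚ N) 0≤A)) 0≤x) (ℚ.<⇒≤ (recip-pos (0<ℕ→ℚ N)))
  S+x≡ : S + x ≡ ℕ→ℚ (suc N) * B
  S+x≡ = sym (trans (solve 3 (λ n s r → n :* (s :* r) := s :* (n :* r)) refl (ℕ→ℚ (suc N)) (S + x) (recip (ℕ→ℚ (suc N))))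
    (trans (cong ((S + x) *_) (*-recip (0<ℕ→ℚ N))) (ℚ.*-identityʳ (S + x))))
  x≡ : x ≡ ℕ→ℚ (suc N) * B - ℕ→ℚ N * A
  x≡ = trans (solve 2 (λ s x → x := (s :+ x) :- s) refl S x) (cong₂ _-_ S+x≡ S≡)

prodℚ : ℕ → (ℕ → ℚ) → ℚ
prodℚ zero    f = 1ℚ
prodℚ (suc n) f = prodℚ n f * f n

amgm-++ : ∀ {N S P} b f → (∀ i → i ℕ.< b → 0ℚ ≤ℚ f i) → AMGM N S P →
          AMGM (b ℕ.+ N) (S + sumℚ b f) (P * prodℚ b f)
amgm-++ {N} {S} {P} zero f 0≤f h = subst₂ (AMGM N) (sym (ℚ.+-identityʳ S)) (sym (ℚ.*-identityʳ P)) h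
amgm-++ {N} {S} {P} (suc b) f 0≤f h = subst₂ (AMGM (suc b ℕ.+ N))
  (ℚ.+-assoc S (sumℚ b f) (f b)) (ℚ.*-assoc P (prodℚ b f) (f b))
  (amgm-snoc (0≤f b (ℕ.n<1+n b)) (amgm-++ b f (λ i i<b → 0≤f i (ℕ.m<n⇒m<1+n i<b)) h))

amgm-replicate : ∀ {N S P} b x → 0ℚ ≤ℚ x → AMGM N S P → AMGM (b ℕ.+ N) (S + ℕ→ℚ b * x) (P * x ^ b)
amgm-replicate {N} {S} {P} b x 0≤x h = subst₂ (λ s p → AMGM (b ℕ.+ N) (S + s) (P * p))
  (sumℚ-const b x) (prodℚ-const b) (amgm-++ b (λ _ → x) (λ _ _ → 0≤x) h)
  where
  prodℚ-const : ∀ b → prodℚ b (λ _ → x) ≡ x ^ b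
  prodℚ-const zero    = refl
  prodℚ-const (suc b) = trans (cong (_* x) (prodℚ-const b)) (ℚ.*-comm (x ^ b) x)

amgm-sum≥ : ∀ {N S P} → AMGM N S P → 1ℚ ≤ℚ P → ℕ→ℚ N ≤ℚ S
amgm-sum≥ {N} {S} {P} (mkAMGM A 0≤A S≡ P≤) 1≤P = subst (ℕ→ℚ N ≤ℚ_) (sym S≡) (N≤NA N (ℚ.≤-trans 1≤P P≤))
  where
  1≤A : ∀ N → 1ℚ ≤ℚ A ^ suc N → 1ℚ ≤ℚ A
  1≤A N 1≤A^ with ℚ.≤-total 1ℚ A
  ... | inj₁ 1≤A = 1≤A
  ... | inj₂ A≤1 = ℚ.≤-trans 1≤A^ (subst (A * A ^ N ≤ℚ_) (ℚ.*-identityʳ A) (*-monoˡ 0≤A (^-≤1 N 0≤A A≤1)))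
  N≤NA : ∀ N → 1ℚ ≤ℚ A ^ N → ℕ→ℚ N ≤ℚ ℕ→ℚ N * A
  N≤NA zero    _    = ℚ.≤-reflexive (sym (ℚ.*-zeroˡ A))
  N≤NA (suc N) 1≤A^ = subst (_≤ℚ ℕ→ℚ (suc N) * A) (ℚ.*-identityʳ _) (*-monoˡ (0≤ℕ→ℚ (suc N)) (1≤A N 1≤A^))

amgm-prod≤1 : ∀ {N S P} → AMGM N S P → S ≤ℚ ℕ→ℚ N → P ≤ℚ 1ℚ
amgm-prod≤1 {zero}  (mkAMGM A 0≤A S≡ P≤) S≤N = P≤
amgm-prod≤1 {suc N} (mkAMGM A 0≤A S≡ P≤) S≤N = ℚ.≤-trans P≤ (^-≤1 (suc N) 0≤A
  (*-cancelˡ (0<ℕ→ℚ N) (subst₂ _≤ℚ_ S≡ (sym (ℚ.*-identityʳ (ℕ→ℚ (suc N)))) S≤N)))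

-- A rational substitute for (1 + x)^n ≤ e^(n x) ≤ 4^m: n factors 1 + x and 2 m factors ½ have sum n
-- + n x + m, at most their number n + 2 m, so their product is at most 1.
[1+x]ⁿ-bound : ∀ n m {x} → 0ℚ ≤ℚ x → ℕ→ℚ n * x ≤ℚ ℕ→ℚ m → (1ℚ + x) ^ n * ½ ^ (m ℕ.+ m) ≤ℚ 1ℚ
[1+x]ⁿ-bound n m {x} 0≤x nx≤m = subst (_≤ℚ 1ℚ) (cong (_* ½ ^ (m ℕ.+ m)) (ℚ.*-identityˡ ((1ℚ + x) ^ n)))
  (amgm-prod≤1 (amgm-replicate (m ℕ.+ m) ½ 0≤½ (amgm-replicate n (1ℚ + x) (0≤+ 0≤1 0≤x) amgm-empty)) (begin
    0ℚ + ℕ→ℚ n * (1ℚ + x) + ℕ→ℚ (m ℕ.+ m) * ½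
      ≡⟨ cong (λ w → 0ℚ + ℕ→ℚ n * (1ℚ + x) + w * ½) (ℕ→ℚ-+ m m) ⟩
    0ℚ + ℕ→ℚ n * (1ℚ + x) + (ℕ→ℚ m + ℕ→ℚ m) * ½
      ≡⟨ solve 3 (λ n x m → con 0ℚ :+ n :* (con 1ℚ :+ x) :+ (m :+ m) :* con ½ := n :* x :+ (m :+ n)) refl (ℕ→ℚ n) x (ℕ→ℚ m) ⟩
    ℕ→ℚ n * x + (ℕ→ℚ m + ℕ→ℚ n)   ≤⟨ ℚ.+-monoˡ-≤ _ nx≤m ⟩
    ℕ→ℚ m + (ℕ→ℚ m + ℕ→ℚ n)       ≡⟨ sym (ℚ.+-assoc (ℕ→ℚ m) (ℕ→ℚ m) (ℕ→ℚ n)) ⟩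
    ℕ→ℚ m + ℕ→ℚ m + ℕ→ℚ n         ≡⟨ cong (_+ ℕ→ℚ n) (sym (ℕ→ℚ-+ m m)) ⟩
    ℕ→ℚ (m ℕ.+ m) + ℕ→ℚ n         ≡⟨ sym (ℕ→ℚ-+ (m ℕ.+ m) n) ⟩
    ℕ→ℚ (m ℕ.+ m ℕ.+ n)           ≡⟨ cong (λ w → ℕ→ℚ (m ℕ.+ m ℕ.+ w)) (sym (ℕ.+-identityʳ n)) ⟩
    ℕ→ℚ (m ℕ.+ m ℕ.+ (n ℕ.+ 0))   ∎))
  where open ℚ.≤-Reasoning

prodℚ-telescope : ∀ (x f : ℕ → ℚ) b → (∀ i → i ℕ.< b → f i * x i ≡ x (suc i)) → prodℚ b f * x 0 ≡ x b
prodℚ-telescope x f zero    h = ℚ.*-identityˡ (x 0)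
prodℚ-telescope x f (suc b) h = begin
  prodℚ b f * f b * x 0    ≡⟨ solve 3 (λ p f x → p :* f :* x := f :* (p :* x)) refl (prodℚ b f) (f b) (x 0) ⟩
  f b * (prodℚ b f * x 0)  ≡⟨ cong (f b *_) (prodℚ-telescope x f b (λ i i<b → h i (ℕ.m<n⇒m<1+n i<b))) ⟩
  f b * x b                ≡⟨ h b (ℕ.n<1+n b) ⟩
  x (suc b)                ∎
  where open ≡-Reasoning

prodℚ-telescope⁻¹ : ∀ (x f : ℕ → ℚ) b → (∀ i → i ℕ.< b → f i * x (suc i) ≡ x i) → prodℚ b f * x b ≡ x 0
prodℚ-telescope⁻¹ x f zero    h = ℚ.*-identityˡ (x 0)
prodℚ-telescope⁻¹ x f (suc b) h = begin
  prodℚ b f * f b * x (suc b)    ≡⟨ ℚ.*-assoc (prodℚ b f) (f b) (x (suc b)) ⟩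
  prodℚ b f * (f b * x (suc b))  ≡⟨ cong (prodℚ b f *_) (h b (ℕ.n<1+n b)) ⟩
  prodℚ b f * x b                ≡⟨ prodℚ-telescope⁻¹ x f b (λ i i<b → h i (ℕ.m<n⇒m<1+n i<b)) ⟩
  x 0                            ∎
  where open ≡-Reasoning

sumℚ-mono : ∀ n {f g} → (∀ i → i ℕ.< n → f i ≤ℚ g i) → sumℚ n f ≤ℚ sumℚ n g
sumℚ-mono zero    h = ℚ.≤-refl
sumℚ-mono (suc n) h = ℚ.+-mono-≤ (sumℚ-mono n (λ i i<n → h i (ℕ.m<n⇒m<1+n i<n))) (h n (ℕ.n<1+n n))

sumℚ-affine : ∀ n c d f → sumℚ n (λ i → c + d * f i) ≡ ℕ→ℚ n * c + d * sumℚ n f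
sumℚ-affine zero    c d f = solve 2 (λ c d → con 0ℚ := con 0ℚ :* c :+ d :* con 0ℚ) refl c d
sumℚ-affine (suc n) c d f = begin
  sumℚ n (λ i → c + d * f i) + (c + d * f n)     ≡⟨ cong (_+ (c + d * f n)) (sumℚ-affine n c d f) ⟩
  ℕ→ℚ n * c + d * sumℚ n f + (c + d * f n)
    ≡⟨ solve 5 (λ n c d s f → n :* c :+ d :* s :+ (c :+ d :* f) := (con 1ℚ :+ n) :* c :+ d :* (s :+ f))
         refl (ℕ→ℚ n) c d (sumℚ n f) (f n) ⟩
  (1ℚ + ℕ→ℚ n) * c + d * (sumℚ n f + f n)        ≡⟨ cong (λ w → w * c + d * (sumℚ n f + f n)) (sym (ℕ→ℚ-suc n)) ⟩
  ℕ→ℚ (suc n) * c + d * (sumℚ n f + f n)         ∎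
  where open ≡-Reasoning

-- Riemann sums against powers of two

module RiemannNodes (a : ℕ) {u : ℚ} (1≤u : 1ℚ ≤ℚ u) where

  A y : ℚ
  A = ℕ→ℚ (suc a)
  y = u - 1ℚ

  -- The partition points 1 + i (u - 1) / A, scaled by A. In these terms `1ℚ + summand i` and
  -- `decay i` are the ratios of consecutive nodes, upwards and downwards, whose products telescope
  -- to u and 1 / u.
  node summand : ℕ → ℚ
  node i = A + ℕ→ℚ i * y
  summand i = y * recip (node i)

  0<A : 0ℚ <ℚ A
  0<A = 0<ℕ→ℚ a

  0≤y : 0ℚ ≤ℚ y
  0≤y = subst (_≤ℚ y) (ℚ.+-inverseʳ 1ℚ) (ℚ.+-monoˡ-≤ (- 1ℚ) 1≤u)

  A≤node : ∀ i → A ≤ℚ node i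
  A≤node i = subst (_≤ℚ node i) (ℚ.+-identityʳ A) (ℚ.+-monoʳ-≤ A (0≤* (0≤ℕ→ℚ i) 0≤y))

  0<node : ∀ i → 0ℚ <ℚ node i
  0<node i = ℚ.<-≤-trans 0<A (A≤node i)

  0≤recip-node : ∀ i → 0ℚ ≤ℚ recip (node i)
  0≤recip-node i = ℚ.<⇒≤ (recip-pos (0<node i))

  0≤summand : ∀ i → 0ℚ ≤ℚ summand i
  0≤summand i = 0≤* 0≤y (0≤recip-node i)

  node-suc : ∀ i → node (suc i) ≡ node i + y
  node-suc i = trans (cong (λ w → A + w * y) (ℕ→ℚ-suc i))
    (solve 3 (λ A i y → A :+ (con 1ℚ :+ i) :* y := A :+ i :* y :+ y) refl A (ℕ→ℚ i) y)

  node-first : node 0 ≡ A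
  node-first = solve 2 (λ A y → A :+ con 0ℚ :* y := A) refl A y

  node-last : node (suc a) ≡ u * A
  node-last = solve 2 (λ A u → A :+ A :* (u :- con 1ℚ) := u :* A) refl A u

  private
    cancel-A : ∀ {v w} → v * A ≡ w * A → v ≡ w
    cancel-A {v} {w} e = trans (undo v) (trans (cong (_* recip A) e) (sym (undo w)))
      where
      undo : ∀ v → v ≡ v * A * recip A
      undo v = sym (trans (ℚ.*-assoc v A (recip A)) (trans (cong (v *_) (*-recip 0<A)) (ℚ.*-identityʳ v)))

  growth : ∀ i → (1ℚ + summand i) * node i ≡ node (suc i)
  growth i = begin
    (1ℚ + y * recip (node i)) * node i
      ≡⟨ solve 3 (λ y r x → (con 1ℚ :+ y :* r) :* x := x :+ y :* (x :* r)) refl y (recip (node i)) (node i) ⟩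
    node i + y * (node i * recip (node i))  ≡⟨ cong (λ w → node i + y * w) (*-recip (0<node i)) ⟩
    node i + y * 1ℚ                         ≡⟨ cong (node i +_) (ℚ.*-identityʳ y) ⟩
    node i + y                              ≡⟨ sym (node-suc i) ⟩
    node (suc i)                            ∎
    where open ≡-Reasoning

  growth-product : prodℚ (suc a) (λ i → 1ℚ + summand i) ≡ u
  growth-product = cancel-A (trans (cong (prodℚ (suc a) (λ i → 1ℚ + summand i) *_) (sym node-first))
    (trans (prodℚ-telescope node (λ i → 1ℚ + summand i) (suc a) (λ i _ → growth i)) node-last))

  decay : ℕ → ℚ
  decay i = node i * recip (node (suc i))

  decay-product : prodℚ (suc a) decay * u ≡ 1ℚ
  decay-product = cancel-A (begin
    prodℚ (suc a) decay * u * A          ≡⟨ ℚ.*-assoc (prodℚ (suc a) decay) u A ⟩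
    prodℚ (suc a) decay * (u * A)        ≡⟨ cong (prodℚ (suc a) decay *_) (sym node-last) ⟩
    prodℚ (suc a) decay * node (suc a)   ≡⟨ prodℚ-telescope⁻¹ node decay (suc a) (λ i _ → shrink i) ⟩
    node 0                               ≡⟨ node-first ⟩
    A                                    ≡⟨ sym (ℚ.*-identityˡ A) ⟩
    1ℚ * A                               ∎)
    where
    open ≡-Reasoning
    shrink : ∀ i → decay i * node (suc i) ≡ node i
    shrink i = trans (solve 3 (λ x r z → x :* r :* z := x :* (z :* r)) refl (node i) (recip (node (suc i))) (node (suc i)))
      (trans (cong (node i *_) (*-recip (0<node (suc i)))) (ℚ.*-identityʳ (node i)))

  -- The growth factors multiply to u, so together with j copies of ½ they have product at least 1.
  -- By AM-GM their sum A + S + j / 2 is at least their number A + j.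
  riemann-lower : ∀ j → ℕ→ℚ (2 ℕ.^ j) ≤ℚ u → ℕ→ℚ j ≤ℚ 2ℚ * riemann (suc a) u
  riemann-lower j 2^j≤u = begin
    J                                            ≡⟨ solve 2 (λ A J → J := con 2ℚ :* ((J :+ A) :- (A :+ J :* con ½))) refl A J ⟩
    2ℚ * ((J + A) - (A + J * ½))                 ≤⟨ *-monoˡ (0≤ℕ→ℚ 2) (ℚ.+-monoˡ-≤ _ bound) ⟩
    2ℚ * ((A + S + J * ½) - (A + J * ½))         ≡⟨ cong (2ℚ *_) (solve 3 (λ A S J → (A :+ S :+ J :* con ½) :- (A :+ J :* con ½) := S) refl A S J) ⟩
    2ℚ * S                                       ∎
    where
    open ℚ.≤-Reasoning
    J S : ℚ
    J = ℕ→ℚ j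
    S = riemann (suc a) u
    1≤product : 1ℚ ≤ℚ 1ℚ * prodℚ (suc a) (λ i → 1ℚ + summand i) * ½ ^ j
    1≤product = begin
      1ℚ                     ≡⟨ sym (^-inverse j refl) ⟩
      2ℚ ^ j * ½ ^ j         ≡⟨ cong (_* ½ ^ j) (sym (ℕ→ℚ-^ 2 j)) ⟩
      ℕ→ℚ (2 ℕ.^ j) * ½ ^ j  ≤⟨ *-monoʳ (0≤^ j 0≤½) 2^j≤u ⟩
      u * ½ ^ j              ≡⟨ cong (_* ½ ^ j) (sym (trans (ℚ.*-identityˡ _) growth-product)) ⟩
      1ℚ * prodℚ (suc a) (λ i → 1ℚ + summand i) * ½ ^ j ∎
    bound : J + A ≤ℚ A + S + J * ½
    bound = begin
      J + A                                                ≡⟨ sym (ℕ→ℚ-+ j (suc a)) ⟩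
      ℕ→ℚ (j ℕ.+ suc a)                                    ≡⟨ cong (λ w → ℕ→ℚ (j ℕ.+ w)) (sym (ℕ.+-identityʳ (suc a))) ⟩
      ℕ→ℚ (j ℕ.+ (suc a ℕ.+ 0))                            ≤⟨ amgm-sum≥ (amgm-replicate j ½ 0≤½
        (amgm-++ (suc a) (λ i → 1ℚ + summand i) (λ i _ → 0≤+ 0≤1 (0≤summand i)) amgm-empty)) 1≤product ⟩
      0ℚ + sumℚ (suc a) (λ i → 1ℚ + summand i) + J * ½     ≡⟨ cong (_+ J * ½) (trans (ℚ.+-identityˡ _) sum≡) ⟩
      A + S + J * ½                                        ∎
      where
      sum≡ : sumℚ (suc a) (λ i → 1ℚ + summand i) ≡ A + S
      sum≡ = trans (sumℚ-cong (suc a) (λ i _ → cong (1ℚ +_) (sym (ℚ.*-identityˡ (summand i)))))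
        (trans (sumℚ-affine (suc a) 1ℚ 1ℚ summand) (cong₂ _+_ (ℚ.*-identityʳ A) (ℚ.*-identityˡ S)))

  -- The decay factors multiply to 1 / u, so together with k copies of 2 they have product at least
  -- 1, and AM-GM bounds the sum of all 1 - `decay i` by k. That sum is the right Riemann sum;
  -- `u ≤ A` keeps the step below every node, so the left sum is at most twice as large.
  riemann-upper : ∀ k → u ≤ℚ ℕ→ℚ (2 ℕ.^ k) → u ≤ℚ A → riemann (suc a) u ≤ℚ 2ℚ * ℕ→ℚ k
  riemann-upper k u≤2^k u≤A = begin
    riemann (suc a) u                            ≤⟨ sumℚ-mono (suc a) (λ i _ → summand≤ i) ⟩
    sumℚ (suc a) (λ i → 2ℚ + (- 2ℚ) * decay i)   ≡⟨ sumℚ-affine (suc a) 2ℚ (- 2ℚ) decay ⟩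
    A * 2ℚ + (- 2ℚ) * S                          ≡⟨ solve 3 (λ A S K → A :* con 2ℚ :+ con (- 2ℚ) :* S := con 2ℚ :* ((K :+ A) :- (S :+ K))) refl A S K ⟩
    2ℚ * ((K + A) - (S + K))                     ≤⟨ *-monoˡ (0≤ℕ→ℚ 2) (ℚ.+-monoˡ-≤ _ bound) ⟩
    2ℚ * ((S + K * 2ℚ) - (S + K))                ≡⟨ solve 2 (λ S K → con 2ℚ :* ((S :+ K :* con 2ℚ) :- (S :+ K)) := con 2ℚ :* K) refl S K ⟩
    2ℚ * K                                       ∎
    where
    open ℚ.≤-Reasoning
    K S : ℚ
    K = ℕ→ℚ k
    S = sumℚ (suc a) decay
    0≤decay : ∀ i → 0ℚ ≤ℚ decay i
    0≤decay i = 0≤* (ℚ.<⇒≤ (0<node i)) (0≤recip-node (suc i))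
    0≤prod : ∀ b → 0ℚ ≤ℚ prodℚ b decay
    0≤prod zero    = 0≤1
    0≤prod (suc b) = 0≤* (0≤prod b) (0≤decay b)
    1≤product : 1ℚ ≤ℚ 1ℚ * prodℚ (suc a) decay * 2ℚ ^ k
    1≤product = begin
      1ℚ                                        ≡⟨ sym decay-product ⟩
      prodℚ (suc a) decay * u                   ≤⟨ *-monoˡ (0≤prod (suc a)) u≤2^k ⟩
      prodℚ (suc a) decay * ℕ→ℚ (2 ℕ.^ k)       ≡⟨ cong₂ _*_ (sym (ℚ.*-identityˡ (prodℚ (suc a) decay))) (ℕ→ℚ-^ 2 k) ⟩
      1ℚ * prodℚ (suc a) decay * 2ℚ ^ k         ∎
    bound : K + A ≤ℚ S + K * 2ℚ
    bound = begin
      K + A                      ≡⟨ sym (ℕ→ℚ-+ k (suc a)) ⟩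
      ℕ→ℚ (k ℕ.+ suc a)          ≡⟨ cong (λ w → ℕ→ℚ (k ℕ.+ w)) (sym (ℕ.+-identityʳ (suc a))) ⟩
      ℕ→ℚ (k ℕ.+ (suc a ℕ.+ 0))  ≤⟨ amgm-sum≥ (amgm-replicate k 2ℚ (0≤ℕ→ℚ 2)
        (amgm-++ (suc a) decay (λ i _ → 0≤decay i) amgm-empty)) 1≤product ⟩
      0ℚ + S + K * 2ℚ            ≡⟨ cong (_+ K * 2ℚ) (ℚ.+-identityˡ S) ⟩
      S + K * 2ℚ                 ∎
    y≤node : ∀ i → y ≤ℚ node i
    y≤node i = ℚ.≤-trans (subst (y ≤ℚ_) (ℚ.+-identityʳ u) (ℚ.+-monoʳ-≤ u (ℚ.nonPositive⁻¹ (- 1ℚ))))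
      (ℚ.≤-trans u≤A (A≤node i))
    -- As y ≤ node i, consecutive nodes differ by a factor at most 2.
    summand≤ : ∀ i → summand i ≤ℚ 2ℚ + (- 2ℚ) * decay i
    summand≤ i = begin
      y * r                             ≡⟨ sym (trans (cong (y * r *_) (*-recip (0<node (suc i)))) (ℚ.*-identityʳ _)) ⟩
      y * r * (node (suc i) * r′)       ≡⟨ cong (λ w → y * r * (w * r′)) (node-suc i) ⟩
      y * r * ((x + y) * r′)            ≤⟨ *-monoˡ (0≤summand i) (*-monoʳ (0≤recip-node (suc i)) (ℚ.+-monoʳ-≤ x (y≤node i))) ⟩
      y * r * ((x + x) * r′)            ≡⟨ solve 4 (λ y r x s → y :* r :* ((x :+ x) :* s) := con 2ℚ :* ((x :* r) :* (y :* s))) refl y r x r′ ⟩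
      2ℚ * ((x * r) * (y * r′))         ≡⟨ cong (λ w → 2ℚ * (w * (y * r′))) (*-recip (0<node i)) ⟩
      2ℚ * (1ℚ * (y * r′))              ≡⟨ solve 3 (λ x y s → con 2ℚ :* (con 1ℚ :* (y :* s)) := con 2ℚ :* ((x :+ y) :* s) :+ con (- 2ℚ) :* (x :* s)) refl x y r′ ⟩
      2ℚ * ((x + y) * r′) + (- 2ℚ) * (x * r′)  ≡⟨ cong (λ w → 2ℚ * (w * r′) + (- 2ℚ) * (x * r′)) (sym (node-suc i)) ⟩
      2ℚ * (node (suc i) * r′) + (- 2ℚ) * (x * r′)  ≡⟨ cong (λ w → 2ℚ * w + (- 2ℚ) * (x * r′)) (*-recip (0<node (suc i))) ⟩
      2ℚ * 1ℚ + (- 2ℚ) * (x * r′)       ≡⟨⟩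
      2ℚ + (- 2ℚ) * decay i             ∎
      where
      x r r′ : ℚ
      x = node i
      r = recip (node i)
      r′ = recip (node (suc i))
open RiemannNodes using (riemann-lower; riemann-upper)

-- Expectations over finite weighted families

degree : ∀ {n} → Graph n → Fin n → ℕ
degree G v = card (tabulate (adjacent G v))

degreeAt : ∀ {n h} → Fin (suc h) → Pairs (Vec Bool (suc h)) n → Fin n → ℕ
degreeAt t X = degree (mapPairs (λ x → lookup x t) X)

LargeDegree : ∀ {n h} → ℕ → Pairs (Vec Bool (suc h)) n → Set
LargeDegree D X = ∃ λ t → ∃ λ v → D ≤ degreeAt t X v

largeDegree? : ∀ {n h} D (X : Pairs (Vec Bool (suc h)) n) → Dec (LargeDegree D X)
largeDegree? D X = any? λ t → any? λ v → D ℕ.≤? degreeAt t X v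

𝟙 : Bool → ℚ
𝟙 b = if b then 1ℚ else 0ℚ

0≤𝟙 : ∀ b → 0ℚ ≤ℚ 𝟙 b
0≤𝟙 true  = 0≤1
0≤𝟙 false = ℚ.≤-refl

-- The pointwise form of Markov's inequality for 2^deg.
𝟙-≤-2^ : ∀ D e (D≤?e : Dec (D ≤ e)) → 𝟙 (does D≤?e) ≤ℚ ½ ^ D * 2ℚ ^ e
𝟙-≤-2^ D e (no  _)   = 0≤* (0≤^ D 0≤½) (0≤^ e (0≤ℕ→ℚ 2))
𝟙-≤-2^ D e (yes D≤e) = begin
  1ℚ                            ≡⟨ sym (^-inverse D refl) ⟩
  ½ ^ D * 2ℚ ^ D                ≡⟨ cong (½ ^ D *_) (sym (ℕ→ℚ-^ 2 D)) ⟩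
  ½ ^ D * ℕ→ℚ (2 ℕ.^ D)         ≤⟨ *-monoˡ (0≤^ D 0≤½) (ℕ→ℚ-mono (ℕ.^-monoʳ-≤ 2 D≤e)) ⟩
  ½ ^ D * ℕ→ℚ (2 ℕ.^ e)         ≡⟨ cong (½ ^ D *_) (ℕ→ℚ-^ 2 e) ⟩
  ½ ^ D * 2ℚ ^ e                ∎
  where open ℚ.≤-Reasoning

-- All weights are evaluated at the k-th terms of their defining sequences,
-- which makes every probability an exact rational number.
module Expectation (k : ℕ) where

  𝔼 : ∀ {A : Set} → Dist A → (A → ℚ) → ℚ
  𝔼 []            f = 0ℚ
  𝔼 ((w , a) ∷ d) f = seq w k * f a + 𝔼 d f

  𝔼-cong : ∀ {A : Set} (d : Dist A) {f g : A → ℚ} → (∀ a → f a ≡ g a) → 𝔼 d f ≡ 𝔼 d g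
  𝔼-cong []            f≗g = refl
  𝔼-cong ((w , a) ∷ d) f≗g = cong₂ (λ x y → seq w k * x + y) (f≗g a) (𝔼-cong d f≗g)

  𝔼-+ : ∀ {A : Set} (d : Dist A) (f g : A → ℚ) → 𝔼 d (λ a → f a + g a) ≡ 𝔼 d f + 𝔼 d g
  𝔼-+ []            f g = refl
  𝔼-+ ((w , a) ∷ d) f g = trans (cong (seq w k * (f a + g a) +_) (𝔼-+ d f g))
    (solve 5 (λ w x y u v → w :* (x :+ y) :+ (u :+ v) := (w :* x :+ u) :+ (w :* y :+ v)) refl
      (seq w k) (f a) (g a) (𝔼 d f) (𝔼 d g))

  𝔼-*ˡ : ∀ {A : Set} (d : Dist A) c (f : A → ℚ) → 𝔼 d (λ a → c * f a) ≡ c * 𝔼 d f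
  𝔼-*ˡ []            c f = sym (ℚ.*-zeroʳ c)
  𝔼-*ˡ ((w , a) ∷ d) c f = trans (cong (seq w k * (c * f a) +_) (𝔼-*ˡ d c f))
    (solve 4 (λ w c x u → w :* (c :* x) :+ c :* u := c :* (w :* x :+ u)) refl (seq w k) c (f a) (𝔼 d f))

  𝔼-*ʳ : ∀ {A : Set} (d : Dist A) c (f : A → ℚ) → 𝔼 d (λ a → f a * c) ≡ 𝔼 d f * c
  𝔼-*ʳ d c f = trans (𝔼-cong d (λ a → ℚ.*-comm (f a) c)) (trans (𝔼-*ˡ d c f) (ℚ.*-comm c (𝔼 d f)))

  𝔼-++ : ∀ {A : Set} (d e : Dist A) (f : A → ℚ) → 𝔼 (d ++ e) f ≡ 𝔼 d f + 𝔼 e f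
  𝔼-++ []            e f = sym (ℚ.+-identityˡ (𝔼 e f))
  𝔼-++ ((w , a) ∷ d) e f = trans (cong (seq w k * f a +_) (𝔼-++ d e f))
    (sym (ℚ.+-assoc (seq w k * f a) (𝔼 d f) (𝔼 e f)))

  𝔼-scale : ∀ {A : Set} w (d : Dist A) (f : A → ℚ) → 𝔼 (map (map₁ (w *ℝ_)) d) f ≡ seq w k * 𝔼 d f
  𝔼-scale w []            f = sym (ℚ.*-zeroʳ (seq w k))
  𝔼-scale w ((v , a) ∷ d) f = trans (cong (seq w k * seq v k * f a +_) (𝔼-scale w d f))
    (solve 4 (λ w v x u → w :* v :* x :+ w :* u := w :* (v :* x :+ u)) refl (seq w k) (seq v k) (f a) (𝔼 d f))

  𝔼-return : ∀ {A : Set} (a : A) (f : A → ℚ) → 𝔼 (return a) f ≡ f a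
  𝔼-return a f = trans (ℚ.+-identityʳ (1ℚ * f a)) (ℚ.*-identityˡ (f a))

  𝔼->>= : ∀ {A B : Set} (d : Dist A) (g : A → Dist B) f → 𝔼 (d >>= g) f ≡ 𝔼 d (λ a → 𝔼 (g a) f)
  𝔼->>= []            g f = refl
  𝔼->>= ((w , a) ∷ d) g f = trans (𝔼-++ (map (map₁ (w *ℝ_)) (g a)) (d >>= g) f)
    (cong₂ _+_ (𝔼-scale w (g a) f) (𝔼->>= d g f))

  𝔼-map : ∀ {A B : Set} (d : Dist A) (h : A → B) f → 𝔼 (d >>= λ a → return (h a)) f ≡ 𝔼 d (λ a → f (h a))
  𝔼-map d h f = trans (𝔼->>= d (λ a → return (h a)) f) (𝔼-cong d (λ a → 𝔼-return (h a) f))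

  𝔼-map₂ : ∀ {A B C : Set} (d : Dist A) (e : Dist B) (h : A → B → C) f →
           𝔼 (d >>= λ a → e >>= λ b → return (h a b)) f ≡ 𝔼 d (λ a → 𝔼 e (λ b → f (h a b)))
  𝔼-map₂ d e h f = trans (𝔼->>= d (λ a → e >>= λ b → return (h a b)) f) (𝔼-cong d (λ a → 𝔼-map e (h a) f))

  Pr≡𝔼 : ∀ {A : Set} (d : Dist A) (E : A → Bool) → seq (Pr d E) k ≡ 𝔼 d (𝟙 ∘ E)
  Pr≡𝔼 []            E = refl
  Pr≡𝔼 ((w , a) ∷ d) E = cong₂ _+_ (weight (E a)) (Pr≡𝔼 d E)
    where
    weight : ∀ b → seq (if b then w else 0ℝ) k ≡ seq w k * 𝟙 b
    weight true  = sym (ℚ.*-identityʳ (seq w k))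
    weight false = sym (ℚ.*-zeroʳ (seq w k))

  -- Nonnegativity of the weights is put as monotonicity of the expectation, a form that passes
  -- through `_>>=_` directly. Neither property is automatic: early terms of p or q may lie outside
  -- [0, 1], so both are derived from bounds on the k-th terms.
  record IsProbability {A : Set} (d : Dist A) : Set where
    field
      𝔼-1    : 𝔼 d (λ _ → 1ℚ) ≡ 1ℚ
      𝔼-mono : ∀ {f g} → (∀ a → f a ≤ℚ g a) → 𝔼 d f ≤ℚ 𝔼 d g

    𝔼-const : ∀ c → 𝔼 d (λ _ → c) ≡ c
    𝔼-const c = trans (𝔼-cong d (λ _ → sym (ℚ.*-identityʳ c)))
      (trans (𝔼-*ˡ d c (λ _ → 1ℚ)) (trans (cong (c *_) 𝔼-1) (ℚ.*-identityʳ c)))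

    union-bound : ∀ m {P : Fin m → A → Set} (P? : ∀ i a → Dec (P i a)) {β} →
                  (∀ i → 𝔼 d (λ a → 𝟙 (does (P? i a))) ≤ℚ β) →
                  𝔼 d (λ a → 𝟙 (does (any? (λ i → P? i a)))) ≤ℚ ℕ→ℚ m * β
    union-bound zero    P? {β} h = ℚ.≤-reflexive (trans (𝔼-const 0ℚ) (sym (ℚ.*-zeroˡ β)))
    union-bound (suc m) P? {β} h = begin
      𝔼 d (λ a → 𝟙 (does (P? zero a) ∨ does (any? (λ i → P? (suc i) a))))
        ≤⟨ 𝔼-mono (λ a → 𝟙-∨ (does (P? zero a)) (does (any? (λ i → P? (suc i) a)))) ⟩
      𝔼 d (λ a → 𝟙 (does (P? zero a)) + 𝟙 (does (any? (λ i → P? (suc i) a))))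
        ≡⟨ 𝔼-+ d (λ a → 𝟙 (does (P? zero a))) (λ a → 𝟙 (does (any? (λ i → P? (suc i) a)))) ⟩
      𝔼 d (λ a → 𝟙 (does (P? zero a))) + 𝔼 d (λ a → 𝟙 (does (any? (λ i → P? (suc i) a))))
        ≤⟨ ℚ.+-mono-≤ (h zero) (union-bound m (λ i → P? (suc i)) (λ i → h (suc i))) ⟩
      β + ℕ→ℚ m * β        ≡⟨ solve 2 (λ b m → b :+ m :* b := (con 1ℚ :+ m) :* b) refl β (ℕ→ℚ m) ⟩
      (1ℚ + ℕ→ℚ m) * β     ≡⟨ cong (_* β) (sym (ℕ→ℚ-suc m)) ⟩
      ℕ→ℚ (suc m) * β      ∎
      where
      open ℚ.≤-Reasoning
      𝟙-∨ : ∀ b c → 𝟙 (b ∨ c) ≤ℚ 𝟙 b + 𝟙 c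
      𝟙-∨ true  c = subst (_≤ℚ 1ℚ + 𝟙 c) (ℚ.+-identityʳ 1ℚ) (ℚ.+-monoʳ-≤ 1ℚ (0≤𝟙 c))
      𝟙-∨ false c = ℚ.≤-reflexive (sym (ℚ.+-identityˡ (𝟙 c)))

    𝔼-not : ∀ (E : A → Bool) → 𝔼 d (λ a → 𝟙 (not (E a))) ≡ 1ℚ - 𝔼 d (𝟙 ∘ E)
    𝔼-not E = trans (solve 2 (λ x y → x := (x :+ y) :- y) refl (𝔼 d (λ a → 𝟙 (not (E a)))) (𝔼 d (𝟙 ∘ E)))
      (cong (_- 𝔼 d (𝟙 ∘ E)) (trans (sym (𝔼-+ d (λ a → 𝟙 (not (E a))) (𝟙 ∘ E))) (trans (𝔼-cong d (λ a → complement (E a))) 𝔼-1)))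
      where
      complement : ∀ b → 𝟙 (not b) + 𝟙 b ≡ 1ℚ
      complement true  = refl
      complement false = refl

  open IsProbability

  return-isProbability : ∀ {A : Set} (a : A) → IsProbability (return a)
  return-isProbability a = record
    { 𝔼-1    = refl
    ; 𝔼-mono = λ {f} {g} f≤g → subst₂ _≤ℚ_ (sym (𝔼-return a f)) (sym (𝔼-return a g)) (f≤g a)
    }

  >>=-isProbability : ∀ {A B : Set} {d : Dist A} {g : A → Dist B} →
                      IsProbability d → (∀ a → IsProbability (g a)) → IsProbability (d >>= g)
  >>=-isProbability {d = d} {g} pd pg = record
    { 𝔼-1    = trans (𝔼->>= d g (λ _ → 1ℚ)) (trans (𝔼-cong d (λ a → 𝔼-1 (pg a))) (𝔼-1 pd))
    ; 𝔼-mono = λ {f} {f′} f≤f′ → subst₂ _≤ℚ_ (sym (𝔼->>= d g f)) (sym (𝔼->>= d g f′))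
        (𝔼-mono pd (λ a → 𝔼-mono (pg a) f≤f′))
    }

  coin-isProbability : ∀ {A : Set} v w {a b : A} → 0ℚ ≤ℚ seq v k → 0ℚ ≤ℚ seq w k → seq v k + seq w k ≡ 1ℚ →
                       IsProbability ((v , a) ∷ (w , b) ∷ [])
  coin-isProbability v w 0≤v 0≤w v+w≡1 = record
    { 𝔼-1    = trans (solve 2 (λ v w → v :* con 1ℚ :+ (w :* con 1ℚ :+ con 0ℚ) := v :+ w) refl (seq v k) (seq w k)) v+w≡1
    ; 𝔼-mono = λ f≤g → ℚ.+-mono-≤ (*-monoˡ 0≤v (f≤g _)) (ℚ.+-monoˡ-≤ 0ℚ (*-monoˡ 0≤w (f≤g _)))
    }

  private
    0≤1- : ∀ {x} → x ≤ℚ 1ℚ → 0ℚ ≤ℚ 1ℚ - x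
    0≤1- {x} x≤1 = subst (_≤ℚ 1ℚ - x) (ℚ.+-inverseʳ x) (ℚ.+-monoˡ-≤ (- x) x≤1)

  bernoulli-isProbability : ∀ {A : Set} w {a b : A} → 0ℚ ≤ℚ seq w k → seq w k ≤ℚ 1ℚ →
                            IsProbability ((1ℝ -ℝ w , a) ∷ (w , b) ∷ [])
  bernoulli-isProbability w 0≤w w≤1 = coin-isProbability (1ℝ -ℝ w) w (0≤1- w≤1) 0≤w
    (solve 1 (λ x → (con 1ℚ :- x) :+ x := con 1ℚ) refl (seq w k))

  bernoulli′-isProbability : ∀ {A : Set} w {a b : A} → 0ℚ ≤ℚ seq w k → seq w k ≤ℚ 1ℚ →
                             IsProbability ((w , a) ∷ (1ℝ -ℝ w , b) ∷ [])
  bernoulli′-isProbability w 0≤w w≤1 = coin-isProbability w (1ℝ -ℝ w) 0≤w (0≤1- w≤1)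
    (solve 1 (λ x → x :+ (con 1ℚ :- x) := con 1ℚ) refl (seq w k))

  iid-isProbability : ∀ {A : Set} {d : Dist A} → IsProbability d → ∀ n → IsProbability (iid d n)
  iid-isProbability pd zero    = return-isProbability []
  iid-isProbability pd (suc n) = >>=-isProbability pd (λ a → >>=-isProbability (iid-isProbability pd n) (λ as → return-isProbability (a ∷ as)))

  iidPairs-isProbability : ∀ {A : Set} {d : Dist A} → IsProbability d → ∀ n → IsProbability (iidPairs d n)
  iidPairs-isProbability pd zero    = return-isProbability []
  iidPairs-isProbability pd (suc n) = >>=-isProbability (iid-isProbability pd n)
    (λ row → >>=-isProbability (iidPairs-isProbability pd n) (λ rest → return-isProbability (row ∷ rest)))

  iid-marginal : ∀ {A : Set} {d : Dist A} → IsProbability d → ∀ {n} (i : Fin n) f →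
                 𝔼 (iid d n) (λ as → f (lookup as i)) ≡ 𝔼 d f
  iid-marginal {d = d} pd {suc n} zero    f = trans (𝔼-map₂ d (iid d n) _∷_ (λ as → f (lookup as zero)))
    (𝔼-cong d (λ a → 𝔼-const (iid-isProbability pd n) (f a)))
  iid-marginal {d = d} pd {suc n} (suc i) f = trans (𝔼-map₂ d (iid d n) _∷_ (λ as → f (lookup as (suc i))))
    (trans (𝔼-const pd (𝔼 (iid d n) (λ as → f (lookup as i)))) (iid-marginal pd i f))

  -- Exponential moments of a degree

  module _ {A : Set} {d : Dist A} (pd : IsProbability d) (edge : A → Bool) where

    private
      bit : Bool → ℚ
      bit b = if b then 2ℚ else 1ℚ

      2^card-∷ : ∀ {n} b (bs : Subset n) → 2ℚ ^ card (b ∷ bs) ≡ bit b * 2ℚ ^ card bs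
      2^card-∷ true  bs = refl
      2^card-∷ false bs = sym (ℚ.*-identityˡ (2ℚ ^ card bs))

    mgf : ℚ
    mgf = 𝔼 d (λ a → bit (edge a))

    𝔼-2^card : ∀ n → 𝔼 (iid d n) (λ as → 2ℚ ^ card (Vec.map edge as)) ≡ mgf ^ n
    𝔼-2^card zero    = refl
    𝔼-2^card (suc n) = begin
      𝔼 (iid d (suc n)) (λ as → 2ℚ ^ card (Vec.map edge as))
        ≡⟨ 𝔼-map₂ d (iid d n) _∷_ (λ as → 2ℚ ^ card (Vec.map edge as)) ⟩
      𝔼 d (λ a → 𝔼 (iid d n) (λ as → 2ℚ ^ card (edge a ∷ Vec.map edge as)))
        ≡⟨ 𝔼-cong d (λ a → trans (𝔼-cong (iid d n) (λ as → 2^card-∷ (edge a) (Vec.map edge as)))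
             (trans (𝔼-*ˡ (iid d n) (bit (edge a)) (λ as → 2ℚ ^ card (Vec.map edge as))) (cong (bit (edge a) *_) (𝔼-2^card n)))) ⟩
      𝔼 d (λ a → bit (edge a) * mgf ^ n)
        ≡⟨ 𝔼-*ʳ d (mgf ^ n) (λ a → bit (edge a)) ⟩
      mgf * mgf ^ n ∎
      where open ≡-Reasoning

    -- The induction follows the layout of `Pairs`. Node zero meets all of the top row; any other
    -- node meets one entry of that row and otherwise lives in the independent `rest`. A node is not
    -- adjacent to itself, hence exponent n among n + 1 nodes.
    𝔼-2^degree : ∀ n (v : Fin (suc n)) →
                 𝔼 (iidPairs d (suc n)) (λ X → 2ℚ ^ degree (mapPairs edge X) v) ≡ mgf ^ n
    𝔼-2^degree n zero = begin
      𝔼 (iidPairs d (suc n)) (λ X → 2ℚ ^ degree (mapPairs edge X) zero)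
        ≡⟨ 𝔼-map₂ (iid d n) (iidPairs d n) _∷_ (λ X → 2ℚ ^ degree (mapPairs edge X) zero) ⟩
      𝔼 (iid d n) (λ row → 𝔼 (iidPairs d n) (λ _ → 2ℚ ^ card (tabulate (lookup (Vec.map edge row)))))
        ≡⟨ 𝔼-cong (iid d n) (λ row → trans (𝔼-const (iidPairs-isProbability pd n) (2ℚ ^ card (tabulate (lookup (Vec.map edge row)))))
             (cong (λ s → 2ℚ ^ card s) (tabulate∘lookup (Vec.map edge row)))) ⟩
      𝔼 (iid d n) (λ row → 2ℚ ^ card (Vec.map edge row))
        ≡⟨ 𝔼-2^card n ⟩
      mgf ^ n ∎
      where open ≡-Reasoning
    𝔼-2^degree (suc n) (suc i) = begin
      𝔼 (iidPairs d (suc (suc n))) (λ X → 2ℚ ^ degree (mapPairs edge X) (suc i))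
        ≡⟨ 𝔼-map₂ (iid d (suc n)) (iidPairs d (suc n)) _∷_ (λ X → 2ℚ ^ degree (mapPairs edge X) (suc i)) ⟩
      𝔼 (iid d (suc n)) (λ row → 𝔼 (iidPairs d (suc n)) (λ rest →
        2ℚ ^ card (lookup (Vec.map edge row) i ∷ tabulate (adjacent (mapPairs edge rest) i))))
        ≡⟨ 𝔼-cong (iid d (suc n)) (λ row → trans
             (𝔼-cong (iidPairs d (suc n)) (λ rest → 2^card-∷ (lookup (Vec.map edge row) i) (tabulate (adjacent (mapPairs edge rest) i))))
             (trans (𝔼-*ˡ (iidPairs d (suc n)) (bit (lookup (Vec.map edge row) i)) (λ rest → 2ℚ ^ degree (mapPairs edge rest) i))
               (cong₂ _*_ (cong bit (lookup-map i edge row)) (𝔼-2^degree n i)))) ⟩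
      𝔼 (iid d (suc n)) (λ row → bit (edge (lookup row i)) * mgf ^ n)
        ≡⟨ 𝔼-*ʳ (iid d (suc n)) (mgf ^ n) (λ row → bit (edge (lookup row i))) ⟩
      𝔼 (iid d (suc n)) (λ row → bit (edge (lookup row i))) * mgf ^ n
        ≡⟨ cong (_* mgf ^ n) (iid-marginal pd i (λ a → bit (edge a))) ⟩
      mgf * mgf ^ n ∎
      where open ≡-Reasoning

    degree-tail : ∀ n (v : Fin (suc n)) D →
                  𝔼 (iidPairs d (suc n)) (λ X → 𝟙 (does (D ℕ.≤? degree (mapPairs edge X) v))) ≤ℚ ½ ^ D * mgf ^ n
    degree-tail n v D = ℚ.≤-trans
      (𝔼-mono (iidPairs-isProbability pd (suc n)) (λ X → 𝟙-≤-2^ D (degree (mapPairs edge X) v) (D ℕ.≤? degree (mapPairs edge X) v)))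
      (ℚ.≤-reflexive (trans (𝔼-*ˡ (iidPairs d (suc n)) (½ ^ D) (λ X → 2ℚ ^ degree (mapPairs edge X) v)) (cong (½ ^ D *_) (𝔼-2^degree n v))))

  -- The two-state chain at a fixed index

  module _ (p q : ℝ) (0<p : 0ℝ <ℝ p) (0<q : 0ℝ <ℝ q)
           (0<pₖ : 0ℚ <ℚ seq p k) (pₖ≤1 : seq p k ≤ℚ 1ℚ)
           (0<qₖ : 0ℚ <ℚ seq q k) (qₖ≤1 : seq q k ≤ℚ 1ℚ) where

    private
      pₖ qₖ p̂ₖ r : ℚ
      pₖ = seq p k
      qₖ = seq q k
      p̂ₖ = seq (stationaryDensity p q 0<p 0<q) k
      r = recip (pₖ + qₖ)

      one : (pₖ + qₖ) * r ≡ 1ℚ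
      one = *-recip (ℚ.+-mono-< 0<pₖ 0<qₖ)

      0≤r : 0ℚ ≤ℚ r
      0≤r = ℚ.<⇒≤ (recip-pos (ℚ.+-mono-< 0<pₖ 0<qₖ))

      balance : p̂ₖ * (pₖ + qₖ) ≡ pₖ
      balance = trans (solve 3 (λ p q r → p :* r :* (p :+ q) := p :* ((p :+ q) :* r)) refl pₖ qₖ r)
        (trans (cong (pₖ *_) one) (ℚ.*-identityʳ pₖ))

    0≤density : 0ℚ ≤ℚ p̂ₖ
    0≤density = 0≤* {pₖ} {r} (ℚ.<⇒≤ 0<pₖ) 0≤r

    density≤1 : p̂ₖ ≤ℚ 1ℚ
    density≤1 = subst (pₖ * r ≤ℚ_) one (*-monoʳ {r} {pₖ} {pₖ + qₖ} 0≤r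
      (subst (_≤ℚ pₖ + qₖ) (ℚ.+-identityʳ pₖ) (ℚ.+-monoʳ-≤ pₖ (ℚ.<⇒≤ 0<qₖ))))

    stationary-isProbability : IsProbability (stationary p q 0<p 0<q)
    stationary-isProbability = bernoulli-isProbability (stationaryDensity p q 0<p 0<q) {false} {true} 0≤density density≤1

    step-isProbability : ∀ x → IsProbability (step p q 0<p 0<q x)
    step-isProbability false = bernoulli-isProbability p (ℚ.<⇒≤ 0<pₖ) pₖ≤1
    step-isProbability true  = bernoulli′-isProbability q (ℚ.<⇒≤ 0<qₖ) qₖ≤1

    pathFrom-isProbability : ∀ x h → IsProbability (pathFrom p q 0<p 0<q x h)
    pathFrom-isProbability x zero    = return-isProbability (x ∷ [])
    pathFrom-isProbability x (suc h) = >>=-isProbability (step-isProbability x)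
      (λ y → >>=-isProbability (pathFrom-isProbability y h) (λ ys → return-isProbability (x ∷ ys)))

    chain : ∀ h → Dist (Vec Bool (suc h))
    chain h = stationary p q 0<p 0<q >>= λ x → pathFrom p q 0<p 0<q x h

    chain-isProbability : ∀ h → IsProbability (chain h)
    chain-isProbability h = >>=-isProbability stationary-isProbability (λ x → pathFrom-isProbability x h)

    -- The two sides differ by (p̂ₖ (pₖ + qₖ) - pₖ) (F false - F true), and `balance` makes the
    -- first factor vanish. Stationarity is thus exact at index k and not merely true in the limit.
    stationary-step : ∀ F → 𝔼 (stationary p q 0<p 0<q) (λ x → 𝔼 (step p q 0<p 0<q x) F) ≡ 𝔼 (stationary p q 0<p 0<q) F
    stationary-step F = trans
      (solve 5 (λ p q s f g →
        (con 1ℚ :- s) :* ((con 1ℚ :- p) :* f :+ (p :* g :+ con 0ℚ)) :+ (s :* (q :* f :+ ((con 1ℚ :- q) :* g :+ con 0ℚ)) :+ con 0ℚ)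
          := ((con 1ℚ :- s) :* f :+ (s :* g :+ con 0ℚ)) :+ (s :* (p :+ q) :- p) :* (f :- g))
        refl pₖ qₖ p̂ₖ (F false) (F true))
      (trans (cong (λ w → 𝔼 (stationary p q 0<p 0<q) F + (w - pₖ) * (F false - F true)) balance)
        (solve 4 (λ e p f g → e :+ (p :- p) :* (f :- g) := e) refl (𝔼 (stationary p q 0<p 0<q) F) pₖ (F false) (F true)))

    𝔼-pathFrom : ∀ x h f → 𝔼 (pathFrom p q 0<p 0<q x (suc h)) f ≡ 𝔼 (step p q 0<p 0<q x) (λ y → 𝔼 (pathFrom p q 0<p 0<q y h) (λ ys → f (x ∷ ys)))
    𝔼-pathFrom x h f = trans (𝔼->>= (step p q 0<p 0<q x) (λ y → pathFrom p q 0<p 0<q y h >>= λ ys → return (x ∷ ys)) f)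
      (𝔼-cong (step p q 0<p 0<q x) (λ y → 𝔼-map (pathFrom p q 0<p 0<q y h) (x ∷_) f))

    pathFrom-head : ∀ x h (f : Bool → ℚ) → 𝔼 (pathFrom p q 0<p 0<q x h) (λ xs → f (lookup xs zero)) ≡ f x
    pathFrom-head x zero    f = 𝔼-return (x ∷ []) (λ xs → f (lookup xs zero))
    pathFrom-head x (suc h) f = begin
      𝔼 (pathFrom p q 0<p 0<q x (suc h)) (λ xs → f (lookup xs zero))
        ≡⟨ 𝔼-pathFrom x h (λ xs → f (lookup xs zero)) ⟩
      𝔼 (step p q 0<p 0<q x) (λ y → 𝔼 (pathFrom p q 0<p 0<q y h) (λ _ → f x))
        ≡⟨ 𝔼-cong (step p q 0<p 0<q x) (λ y → 𝔼-const (pathFrom-isProbability y h) (f x)) ⟩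
      𝔼 (step p q 0<p 0<q x) (λ _ → f x)
        ≡⟨ 𝔼-const (step-isProbability x) (f x) ⟩
      f x ∎
      where open ≡-Reasoning

    -- Averaging over the initial state and applying `stationary-step` turns the chain observed from
    -- time 1 into a stationary chain with a horizon shorter by one.
    chain-marginal : ∀ h (t : Fin (suc h)) f → 𝔼 (chain h) (λ xs → f (lookup xs t)) ≡ 𝔼 (stationary p q 0<p 0<q) f
    chain-marginal h zero f = trans (𝔼->>= (stationary p q 0<p 0<q) (λ x → pathFrom p q 0<p 0<q x h) (λ xs → f (lookup xs zero)))
      (𝔼-cong (stationary p q 0<p 0<q) (λ x → pathFrom-head x h f))
    chain-marginal (suc h) (suc t) f = begin
      𝔼 (chain (suc h)) (λ xs → f (lookup xs (suc t)))
        ≡⟨ 𝔼->>= (stationary p q 0<p 0<q) (λ x → pathFrom p q 0<p 0<q x (suc h)) (λ xs → f (lookup xs (suc t))) ⟩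
      𝔼 (stationary p q 0<p 0<q) (λ x → 𝔼 (pathFrom p q 0<p 0<q x (suc h)) (λ xs → f (lookup xs (suc t))))
        ≡⟨ 𝔼-cong (stationary p q 0<p 0<q) (λ x → 𝔼-pathFrom x h (λ xs → f (lookup xs (suc t)))) ⟩
      𝔼 (stationary p q 0<p 0<q) (λ x → 𝔼 (step p q 0<p 0<q x) (λ y → 𝔼 (pathFrom p q 0<p 0<q y h) (λ ys → f (lookup ys t))))
        ≡⟨ stationary-step (λ y → 𝔼 (pathFrom p q 0<p 0<q y h) (λ ys → f (lookup ys t))) ⟩
      𝔼 (stationary p q 0<p 0<q) (λ y → 𝔼 (pathFrom p q 0<p 0<q y h) (λ ys → f (lookup ys t)))
        ≡⟨ sym (𝔼->>= (stationary p q 0<p 0<q) (λ x → pathFrom p q 0<p 0<q x h) (λ xs → f (lookup xs t))) ⟩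
      𝔼 (chain h) (λ xs → f (lookup xs t))
        ≡⟨ chain-marginal h t f ⟩
      𝔼 (stationary p q 0<p 0<q) f ∎
      where open ≡-Reasoning

    chain-mgf : ∀ h t → mgf (chain-isProbability h) (λ x → lookup x t) ≡ 1ℚ + p̂ₖ
    chain-mgf h t = trans (chain-marginal h t (λ b → if b then 2ℚ else 1ℚ))
      (solve 1 (λ s → (con 1ℚ :- s) :* con 1ℚ :+ (s :* con 2ℚ :+ con 0ℚ) := con 1ℚ :+ s) refl p̂ₖ)

    maxDegree-tail : ∀ n h D →
      𝔼 (edgeMEG p q 0<p 0<q (suc n) h) (λ X → 𝟙 (does (largeDegree? D X))) ≤ℚ
        ℕ→ℚ (suc h) * (ℕ→ℚ (suc n) * (½ ^ D * (1ℚ + p̂ₖ) ^ n))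
    maxDegree-tail n h D = union-bound pX (suc h) (λ t X → any? λ v → D ℕ.≤? degreeAt t X v) {ℕ→ℚ (suc n) * β}
      λ t → union-bound pX (suc n) (λ v X → D ℕ.≤? degreeAt t X v) {β}
      λ v → subst (λ w → 𝔼 (edgeMEG p q 0<p 0<q (suc n) h) (λ X → 𝟙 (does (D ℕ.≤? degreeAt t X v))) ≤ℚ ½ ^ D * w ^ n)
        (chain-mgf h t) (degree-tail (chain-isProbability h) (λ x → lookup x t) n v D)
      where
      β : ℚ
      β = ½ ^ D * (1ℚ + p̂ₖ) ^ n
      pX : IsProbability (edgeMEG p q 0<p 0<q (suc n) h)
      pX = iidPairs-isProbability (chain-isProbability h) (suc n)

    Pr-maxDegree : ∀ n h D →
      1ℚ - ℕ→ℚ (suc h) * (ℕ→ℚ (suc n) * (½ ^ D * (1ℚ + p̂ₖ) ^ n)) ≤ℚ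
        seq (Pr (edgeMEG p q 0<p 0<q (suc n) h) (λ X → not (does (largeDegree? D X)))) k
    Pr-maxDegree n h D = begin
      1ℚ - bound
        ≤⟨ ℚ.+-monoʳ-≤ 1ℚ (ℚ.neg-antimono-≤ (maxDegree-tail n h D)) ⟩
      1ℚ - 𝔼 (edgeMEG p q 0<p 0<q (suc n) h) (λ X → 𝟙 (does (largeDegree? D X)))
        ≡⟨ sym (𝔼-not (iidPairs-isProbability (chain-isProbability h) (suc n)) (λ X → does (largeDegree? D X))) ⟩
      𝔼 (edgeMEG p q 0<p 0<q (suc n) h) (λ X → 𝟙 (not (does (largeDegree? D X))))
        ≡⟨ sym (Pr≡𝔼 (edgeMEG p q 0<p 0<q (suc n) h) (λ X → not (does (largeDegree? D X)))) ⟩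
      seq (Pr (edgeMEG p q 0<p 0<q (suc n) h) (λ X → not (does (largeDegree? D X)))) k ∎
      where
      open ℚ.≤-Reasoning
      bound : ℚ
      bound = ℕ→ℚ (suc h) * (ℕ→ℚ (suc n) * (½ ^ D * (1ℚ + p̂ₖ) ^ n))

-- Growth of the informed set

ι : Bool → ℕ
ι b = if b then 1 else 0

card≡sum : ∀ {n} (S : Subset n) → card S ≡ sum (λ v → ι (lookup S v))
card≡sum []          = refl
card≡sum (true  ∷ S) = cong suc (card≡sum S)
card≡sum (false ∷ S) = card≡sum S

sum-mono : ∀ {n} {f g : Fin n → ℕ} → (∀ i → f i ≤ g i) → sum f ≤ sum g
sum-mono {zero}  f≤g = z≤n
sum-mono {suc n} f≤g = ℕ.+-mono-≤ (f≤g zero) (sum-mono (λ i → f≤g (suc i)))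

term≤sum : ∀ {n} (f : Fin n → ℕ) i → f i ≤ sum f
term≤sum f zero    = ℕ.m≤m+n (f zero) _
term≤sum f (suc i) = ℕ.≤-trans (term≤sum (f ∘ suc) i) (ℕ.m≤n+m _ (f zero))

degree≡sum : ∀ {n} (G : Graph n) u → degree G u ≡ sum (λ v → ι (adjacent G u v))
degree≡sum G u = trans (card≡sum (tabulate (adjacent G u)))
  (sum-cong-≗ (λ v → cong ι (lookup∘tabulate (adjacent G u) v)))

does-true : ∀ {A : Set} (A? : Dec A) → does A? ≡ true → A
does-true (yes a) _ = a

module _ {n} (G : Graph n) (I : Subset n) where

  private
    arrivals : Fin n → ℕ
    arrivals v = sum (λ u → ι (lookup I u) ℕ.* ι (adjacent G u v))

  neighbour-arrival : ∀ v → ι (lookup (neighbours G I) v) ≤ arrivals v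
  neighbour-arrival v with lookup (neighbours G I) v in eq
  ... | false = z≤n
  ... | true
    with _ , u , u∈I , uv ← does-true (¬? (v ∈? I) ×-dec any? (λ u → (u ∈? I) ×-dec (adjacent G u v Bool.≟ true)))
           (trans (sym (lookup∘tabulate _ v)) eq)
    = ℕ.≤-trans (ℕ.≤-reflexive (sym (cong₂ (λ a b → ι a ℕ.* ι b) ([]=⇒lookup u∈I) uv)))
        (term≤sum (λ u → ι (lookup I u) ℕ.* ι (adjacent G u v)) u)

  ι-∪ : ∀ v → ι (lookup (I ∪ neighbours G I) v) ≤ ι (lookup I v) ℕ.+ arrivals v
  ι-∪ v = ℕ.≤-trans (ℕ.≤-reflexive (cong ι (lookup-zipWith _∨_ v I (neighbours G I))))
    (ℕ.≤-trans (ι-∨ (lookup I v) _) (ℕ.+-monoʳ-≤ (ι (lookup I v)) (neighbour-arrival v)))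
    where
    ι-∨ : ∀ a b → ι (a ∨ b) ≤ ι a ℕ.+ ι b
    ι-∨ true  b = s≤s z≤n
    ι-∨ false b = ℕ.≤-refl

  -- Double counting: a newly informed node has at least one edge from I, and the edges between I
  -- and all nodes are summed by their end in I instead. Each node of I pays for itself and its
  -- neighbours, 1 + deg ≤ D, which is why a strict degree bound gives the factor D itself.
  card-∪-neighbours : ∀ D → (∀ u → degree G u ℕ.< D) → card (I ∪ neighbours G I) ≤ D ℕ.* card I
  card-∪-neighbours D deg<D = begin
    card (I ∪ neighbours G I)
      ≡⟨ card≡sum (I ∪ neighbours G I) ⟩
    sum (λ v → ι (lookup (I ∪ neighbours G I) v))
      ≤⟨ sum-mono ι-∪ ⟩
    sum (λ v → ι (lookup I v) ℕ.+ arrivals v)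
      ≡⟨ ∑-distrib-+ (λ v → ι (lookup I v)) arrivals ⟩
    sum (λ v → ι (lookup I v)) ℕ.+ sum arrivals
      ≡⟨ cong (sum (λ v → ι (lookup I v)) ℕ.+_) (∑-comm (λ v u → ι (lookup I u) ℕ.* ι (adjacent G u v))) ⟩
    sum (λ u → ι (lookup I u)) ℕ.+ sum (λ u → sum (λ v → ι (lookup I u) ℕ.* ι (adjacent G u v)))
      ≡⟨ sym (∑-distrib-+ (λ u → ι (lookup I u)) (λ u → sum (λ v → ι (lookup I u) ℕ.* ι (adjacent G u v)))) ⟩
    sum (λ u → ι (lookup I u) ℕ.+ sum (λ v → ι (lookup I u) ℕ.* ι (adjacent G u v)))
      ≤⟨ sum-mono departures ⟩
    sum (λ u → D ℕ.* ι (lookup I u))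
      ≡⟨ sym (*-distribˡ-sum D (λ u → ι (lookup I u))) ⟩
    D ℕ.* sum (λ u → ι (lookup I u))
      ≡⟨ cong (D ℕ.*_) (sym (card≡sum I)) ⟩
    D ℕ.* card I ∎
    where
    open ℕ.≤-Reasoning
    departures : ∀ u → ι (lookup I u) ℕ.+ sum (λ v → ι (lookup I u) ℕ.* ι (adjacent G u v)) ≤ D ℕ.* ι (lookup I u)
    departures u = begin
      ι (lookup I u) ℕ.+ sum (λ v → ι (lookup I u) ℕ.* ι (adjacent G u v))
        ≡⟨ cong (ι (lookup I u) ℕ.+_) (trans (sym (*-distribˡ-sum (ι (lookup I u)) (λ v → ι (adjacent G u v))))
             (cong (ι (lookup I u) ℕ.*_) (sym (degree≡sum G u)))) ⟩
      ι (lookup I u) ℕ.+ ι (lookup I u) ℕ.* degree G u  ≡⟨ sym (ℕ.*-suc (ι (lookup I u)) (degree G u)) ⟩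
      ι (lookup I u) ℕ.* suc (degree G u)               ≤⟨ ℕ.*-monoʳ-≤ (ι (lookup I u)) (deg<D u) ⟩
      ι (lookup I u) ℕ.* D                              ≡⟨ ℕ.*-comm (ι (lookup I u)) D ⟩
      D ℕ.* ι (lookup I u)                              ∎

card-informed : ∀ {n} (X : Trajectory n) s D t → (∀ t′ → t′ ℕ.< t → ∀ u → degree (graphAt X t′) u ℕ.< D) →
                card (informed X s t) ≤ D ℕ.^ t
card-informed X s D zero    deg<D = ℕ.≤-reflexive (∣⁅x⁆∣≡1 s)
card-informed X s D (suc t) deg<D = ℕ.≤-trans
  (card-∪-neighbours (graphAt X t) (informed X s t) D (deg<D t (ℕ.n<1+n t)))
  (ℕ.*-monoʳ-≤ D (card-informed X s D t (λ t′ t′<t → deg<D t′ (ℕ.m<n⇒m<1+n t′<t))))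

mapPairs-∘ : ∀ {A B C : Set} {n} {f : B → C} {g : A → B} {e : A → C} → (∀ x → f (g x) ≡ e x) →
             (X : Pairs A n) → mapPairs f (mapPairs g X) ≡ mapPairs e X
mapPairs-∘ fg≗e []           = refl
mapPairs-∘ {f = f} {g} fg≗e (row ∷ rest) = cong₂ _∷_
  (trans (sym (map-∘ f g row)) (map-cong fg≗e row)) (mapPairs-∘ fg≗e rest)

graphAt-prefix : ∀ {n} h (t : Fin (suc h)) (X : Trajectory n) →
                 mapPairs (λ x → lookup x t) (prefix h X) ≡ graphAt X (toℕ t)
graphAt-prefix h t = mapPairs-∘ (λ x → lookup∘tabulate (λ t → x (toℕ t)) t)

n≤2^n : ∀ n → n ≤ 2 ℕ.^ n
n≤2^n zero    = z≤n
n≤2^n (suc n) = ℕ.≤-trans (ℕ.+-mono-≤ (ℕ.m^n>0 2 n) (n≤2^n n))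
  (ℕ.≤-reflexive (cong (2 ℕ.^ n ℕ.+_) (sym (ℕ.+-identityʳ (2 ℕ.^ n)))))

-- The event sees the graphs G_0, ..., G_n only. For T ≤ n + 1 these include G_0, ..., G_(T-1),
-- which determine I_T. For larger T the degrees do not matter, since n + 1 ≤ 2^(n+1) ≤ D^T. So a
-- horizon known in advance suffices although T may be arbitrarily large.
flooding-size : ∀ {n} D (X : Trajectory (suc n)) → 2 ≤ D → ¬ LargeDegree D (prefix n X) →
                ∀ T → IsFloodingTime X T → suc n ≤ D ℕ.^ T
flooding-size {n} D X 2≤D ¬large T (_ , s , full , _) with T ℕ.≤? suc n
... | yes T≤n = subst (_≤ D ℕ.^ T) (trans (cong card full) (∣⊤∣≡n (suc n)))
        (card-informed X s D T λ t t<T u → ℕ.≰⇒> λ D≤deg →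
          let t<1+n = ℕ.<-≤-trans t<T T≤n in
          ¬large (Fin.fromℕ< t<1+n , u , subst (λ G → D ≤ degree G u)
            (sym (trans (graphAt-prefix n (Fin.fromℕ< t<1+n) X) (cong (graphAt X) (toℕ-fromℕ< t<1+n)))) D≤deg))
... | no  T≰n = ℕ.≤-trans (n≤2^n (suc n)) (ℕ.≤-trans (ℕ.^-monoˡ-≤ (suc n) 2≤D)
        (ℕ.^-monoʳ-≤ D {{ℕ.>-nonZero (ℕ.<-≤-trans (s≤s z≤n) 2≤D)}} (ℕ.<⇒≤ (ℕ.≰⇒> T≰n))))

-- Binary scales

binaryLog : ∀ n → ∃ λ ℓ → 2 ℕ.^ ℓ ≤ suc n × suc n ℕ.< 2 ℕ.^ suc ℓ
binaryLog zero = 0 , s≤s z≤n , s≤s (s≤s z≤n)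
binaryLog (suc n) with binaryLog n
... | ℓ , lo , hi with suc (suc n) ℕ.<? 2 ℕ.^ suc ℓ
...   | yes <  = ℓ , ℕ.m≤n⇒m≤1+n lo , <
...   | no  ≮  = suc ℓ , ℕ.≮⇒≥ ≮ , ℕ.≤-<-trans hi (ℕ.^-monoʳ-< 2 (s≤s (s≤s z≤n)) (ℕ.n<1+n (suc ℓ)))

^-cancelʳ-< : ∀ {a b} → 2 ℕ.^ a ℕ.< 2 ℕ.^ b → a ℕ.< b
^-cancelʳ-< {a} {b} h with a ℕ.<? b
... | yes a<b = a<b
... | no  a≮b = ⊥-elim (ℕ.<⇒≱ h (ℕ.^-monoʳ-≤ 2 (ℕ.≮⇒≥ a≮b)))

ceiling : ∀ M x → 0ℚ ≤ℚ x → x ≤ℚ ℕ→ℚ M → ∃ λ m → x ≤ℚ ℕ→ℚ m × ℕ→ℚ m ≤ℚ x + 1ℚ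
ceiling zero    x 0≤x x≤M = 0 , x≤M , ℚ.+-mono-≤ 0≤x 0≤1
ceiling (suc M) x 0≤x x≤M with ℚ.≤-total x (ℕ→ℚ M)
... | inj₁ x≤M′ = ceiling M x 0≤x x≤M′
... | inj₂ M≤x  = suc M , x≤M , ℚ.≤-trans
      (ℚ.≤-reflexive (trans (ℕ→ℚ-suc M) (ℚ.+-comm 1ℚ (ℕ→ℚ M)))) (ℚ.+-monoˡ-≤ 1ℚ M≤x)

natural-bound : ∀ x → 0ℚ <ℚ x → ∃ λ M → x ≤ℚ ℕ→ℚ M
natural-bound x 0<x = let N , arch = archimedean (recip x) (recip-pos 0<x) in suc N ,
  (begin
    x                                                  ≡⟨ sym (ℚ.*-identityʳ x) ⟩
    x * 1ℚ                                             ≡⟨ cong (x *_) (sym (*-recip (0<ℕ→ℚ N))) ⟩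
    x * (ℕ→ℚ (suc N) * recip (ℕ→ℚ (suc N)))            ≤⟨ *-monoˡ (ℚ.<⇒≤ 0<x) (*-monoˡ (0≤ℕ→ℚ (suc N)) (arch N ℕ.≤-refl)) ⟩
    x * (ℕ→ℚ (suc N) * recip x)                        ≡⟨ solve 3 (λ x n r → x :* (n :* r) := n :* (x :* r)) refl x (ℕ→ℚ (suc N)) (recip x) ⟩
    ℕ→ℚ (suc N) * (x * recip x)                        ≡⟨ cong (ℕ→ℚ (suc N) *_) (*-recip 0<x) ⟩
    ℕ→ℚ (suc N) * 1ℚ                                   ≡⟨ ℚ.*-identityʳ (ℕ→ℚ (suc N)) ⟩
    ℕ→ℚ (suc N)                                        ∎)
  where open ℚ.≤-Reasoning

p≤∣p∣ : ∀ p → p ≤ℚ ∣ p ∣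
p≤∣p∣ p with ℚ.≤-total 0ℚ p
... | inj₁ 0≤p = ℚ.≤-reflexive (sym (ℚ.0≤p⇒∣p∣≡p 0≤p))
... | inj₂ p≤0 = ℚ.≤-trans p≤0 (ℚ.0≤∣p∣ p)

∣x-y∣≤1⇒x≤y+1 : ∀ x y → ∣ x - y ∣ ≤ℚ 1ℚ → x ≤ℚ y + 1ℚ
∣x-y∣≤1⇒x≤y+1 x y h = begin
  x            ≡⟨ solve 2 (λ x y → x := y :+ (x :- y)) refl x y ⟩
  y + (x - y)  ≤⟨ ℚ.+-monoʳ-≤ y (ℚ.≤-trans (p≤∣p∣ (x - y)) h) ⟩
  y + 1ℚ       ∎
  where open ℚ.≤-Reasoning

-- A real cannot be rounded, but one late term of its sequence can. The slack 3 is made of 1 for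
-- padding that term so that later terms stay below m, 1 for rounding up, and 1 for the Cauchy
-- tolerance on the way back.
eventual-ceiling : ∀ (x : ℝ) → (∃ λ N → ∀ k → N ≤ k → 0ℚ ≤ℚ seq x k) →
  ∃ λ m → ∃ λ N → ∀ k → N ≤ k → seq x k ≤ℚ ℕ→ℚ m × ℕ→ℚ m ≤ℚ seq x k + ℕ→ℚ 3
eventual-ceiling x (N₀ , 0≤x) =
  let N₁ , close = cauchy x 1ℚ 0<1
      N   = N₀ ℕ.⊔ N₁
      z   = seq x N + 1ℚ
      0≤z = 0≤+ (0≤x N (ℕ.m≤m⊔n N₀ N₁)) 0≤1
      M , z+1≤M = natural-bound (z + 1ℚ) (ℚ.<-≤-trans 0<1 (subst (_≤ℚ z + 1ℚ) (ℚ.+-identityˡ 1ℚ) (ℚ.+-monoˡ-≤ 1ℚ 0≤z)))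
      z≤z+1 = subst (_≤ℚ z + 1ℚ) (ℚ.+-identityʳ z) (ℚ.+-monoʳ-≤ z 0≤1)
      m , z≤m , m≤z+1 = ceiling M z 0≤z (ℚ.≤-trans z≤z+1 z+1≤M)
  in m , N , λ k N≤k →
    let N₁≤k = ℕ.≤-trans (ℕ.m≤n⊔m N₀ N₁) N≤k
        N₁≤N = ℕ.m≤n⊔m N₀ N₁
    in ℚ.≤-trans (∣x-y∣≤1⇒x≤y+1 (seq x k) (seq x N) (close k N N₁≤k N₁≤N)) z≤m
     , ℚ.≤-trans m≤z+1 (subst (z + 1ℚ ≤ℚ_)
         (solve 1 (λ s → s :+ con 1ℚ :+ con 1ℚ :+ con 1ℚ := s :+ con (ℕ→ℚ 3)) refl (seq x k))
         (ℚ.+-monoˡ-≤ 1ℚ (ℚ.+-monoˡ-≤ 1ℚ (∣x-y∣≤1⇒x≤y+1 (seq x N) (seq x k) (close N k N₁≤N N₁≤k)))))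

-- With  n ≤ 2^ℓ  and  n x ≤ m,  a fixed degree reaches this threshold with
-- probability at most n⁻³.
threshold : ℕ → ℕ → ℕ
threshold m ℓ = m ℕ.+ m ℕ.+ (ℓ ℕ.+ (ℓ ℕ.+ ℓ))

-- The halvings in `threshold` are spent as follows: 2 m of them cancel the moment (1 + x)^n by
-- `[1+x]ⁿ-bound`, and ℓ of them cancel each of three factors N, namely the number of nodes, the
-- number of times and the target probability 1 / N.
tail-small : ∀ n m ℓ {x} → 0ℚ ≤ℚ x → ℕ→ℚ n * x ≤ℚ ℕ→ℚ m → suc n ≤ 2 ℕ.^ ℓ →
  ℕ→ℚ (suc n) * (ℕ→ℚ (suc n) * (½ ^ threshold m ℓ * (1ℚ + x) ^ n)) ≤ℚ recip (ℕ→ℚ (suc n))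
tail-small n m ℓ {x} 0≤x nx≤m n≤2^ℓ = *-cancelˡ {N} (0<ℕ→ℚ n) (begin
  N * (N * (N * (½ ^ threshold m ℓ * θ)))
    ≡⟨ cong (λ w → N * (N * (N * (w * θ)))) (trans (^-homo-* ½ (m ℕ.+ m) (ℓ ℕ.+ (ℓ ℕ.+ ℓ)))
         (cong (a *_) (trans (^-homo-* ½ ℓ (ℓ ℕ.+ ℓ)) (cong (b *_) (^-homo-* ½ ℓ ℓ))))) ⟩
  N * (N * (N * (a * (b * (b * b)) * θ)))
    ≡⟨ solve 4 (λ N a b t → N :* (N :* (N :* (a :* (b :* (b :* b)) :* t))) := (t :* a) :* ((N :* b) :* ((N :* b) :* (N :* b)))) refl N a b θ ⟩
  (θ * a) * ((N * b) * ((N * b) * (N * b)))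
    ≤⟨ *-mono-≤-nonNeg (0≤* (0≤^ n (0≤+ 0≤1 0≤x)) (0≤^ (m ℕ.+ m) 0≤½)) ([1+x]ⁿ-bound n m 0≤x nx≤m)
         (0≤* 0≤Nb (0≤* 0≤Nb 0≤Nb)) (*-mono-≤-nonNeg 0≤Nb Nb≤1 (0≤* 0≤Nb 0≤Nb) (*-mono-≤-nonNeg 0≤Nb Nb≤1 0≤Nb Nb≤1)) ⟩
  1ℚ
    ≡⟨ sym (*-recip (0<ℕ→ℚ n)) ⟩
  N * recip N ∎)
  where
  open ℚ.≤-Reasoning
  N a b θ : ℚ
  N = ℕ→ℚ (suc n)
  a = ½ ^ (m ℕ.+ m)
  b = ½ ^ ℓ
  θ = (1ℚ + x) ^ n
  0≤Nb : 0ℚ ≤ℚ N * b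
  0≤Nb = 0≤* (0≤ℕ→ℚ (suc n)) (0≤^ ℓ 0≤½)
  Nb≤1 : N * b ≤ℚ 1ℚ
  Nb≤1 = begin
    N * b                   ≤⟨ *-monoʳ (0≤^ ℓ 0≤½) (ℕ→ℚ-mono n≤2^ℓ) ⟩
    ℕ→ℚ (2 ℕ.^ ℓ) * b       ≡⟨ cong (_* b) (ℕ→ℚ-^ 2 ℓ) ⟩
    2ℚ ^ ℓ * ½ ^ ℓ          ≡⟨ ^-inverse ℓ refl ⟩
    1ℚ                      ∎

-- Since 3 ≤ 2^(j+1), m = 3 + m′ is at most 2^(j+2). The threshold is at most 5 m, padded to 8 m ≤
-- 2^(j+5), and 1 ≤ j absorbs the 5 into a multiple of j. This is what turns D = O(n p̂) into log D
-- = O(log (n p̂)).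
threshold≤2^ : ∀ m′ ℓ j → ℓ ≤ 3 ℕ.+ m′ → m′ ℕ.< 2 ℕ.^ suc j → 1 ≤ j → threshold (3 ℕ.+ m′) ℓ ≤ 2 ℕ.^ (6 ℕ.* j)
threshold≤2^ m′ ℓ j ℓ≤m m′<2^ 1≤j = begin
  threshold m ℓ                    ≤⟨ ℕ.+-monoʳ-≤ (m ℕ.+ m) (ℕ.+-mono-≤ ℓ≤m (ℕ.+-mono-≤ ℓ≤m ℓ≤m)) ⟩
  threshold m m                    ≤⟨ ℕ.m≤n+m (threshold m m) (3 ℕ.* m) ⟩
  3 ℕ.* m ℕ.+ threshold m m        ≡⟨ eight m ⟩
  8 ℕ.* m                          ≤⟨ ℕ.*-monoʳ-≤ 8 m≤ ⟩
  8 ℕ.* (2 ℕ.* 2 ℕ.^ suc j)        ≡⟨ sym (ℕ.^-distribˡ-+-* 2 3 (suc (suc j))) ⟩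
  2 ℕ.^ (5 ℕ.+ j)                  ≤⟨ ℕ.^-monoʳ-≤ 2 5+j≤6j ⟩
  2 ℕ.^ (6 ℕ.* j)                  ∎
  where
  open ℕ.≤-Reasoning
  m : ℕ
  m = 3 ℕ.+ m′
  eight : ∀ m → 3 ℕ.* m ℕ.+ (m ℕ.+ m ℕ.+ (m ℕ.+ (m ℕ.+ m))) ≡ 8 ℕ.* m
  eight = solve-∀
  m≤ : m ≤ 2 ℕ.* 2 ℕ.^ suc j
  m≤ = begin
    3 ℕ.+ m′                           ≤⟨ ℕ.+-mono-≤ (ℕ.≤-trans (ℕ.n≤1+n 3) (ℕ.^-monoʳ-≤ 2 (s≤s 1≤j))) (ℕ.<⇒≤ m′<2^) ⟩
    2 ℕ.^ suc j ℕ.+ 2 ℕ.^ suc j        ≡⟨ cong (2 ℕ.^ suc j ℕ.+_) (sym (ℕ.+-identityʳ (2 ℕ.^ suc j))) ⟩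
    2 ℕ.* 2 ℕ.^ suc j                  ∎
  5+j≤6j : 5 ℕ.+ j ≤ 6 ℕ.* j
  5+j≤6j = begin
    5 ℕ.+ j            ≤⟨ ℕ.+-monoˡ-≤ j (ℕ.*-monoʳ-≤ 5 1≤j) ⟩
    5 ℕ.* j ℕ.+ j      ≡⟨ ℕ.+-comm (5 ℕ.* j) j ⟩
    6 ℕ.* j            ∎

-- The origin of c = 4: the Riemann sum is at least ℓ / 2, so the density hypothesis gives n p̂ ≥ 2
-- ℓ up to a slack of 1, and 2 ℓ - 1 ≥ ℓ + 1 for ℓ ≥ 2.
density-≥-log : ∀ n ℓ k {x} → 2 ℕ.^ ℓ ≤ suc n → 2 ≤ ℓ →
  ℕ→ℚ 4 * (riemann (suc k) (ℕ→ℚ (suc n)) * recip (ℕ→ℚ (suc n))) ≤ℚ x + recip (ℕ→ℚ (suc n)) →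
  ℕ→ℚ (suc ℓ) ≤ℚ ℕ→ℚ (suc n) * x
density-≥-log n ℓ k {x} 2^ℓ≤n 2≤ℓ h = begin
  ℕ→ℚ (suc ℓ)                     ≡⟨ trans (ℕ→ℚ-suc ℓ) (solve 1 (λ l → con 1ℚ :+ l := (con (ℕ→ℚ 2) :+ l) :- con 1ℚ) refl (ℕ→ℚ ℓ)) ⟩
  (ℕ→ℚ 2 + ℕ→ℚ ℓ) - 1ℚ            ≤⟨ ℚ.+-monoˡ-≤ (- 1ℚ) (ℚ.+-monoˡ-≤ (ℕ→ℚ ℓ) (ℕ→ℚ-mono 2≤ℓ)) ⟩
  (ℕ→ℚ ℓ + ℕ→ℚ ℓ) - 1ℚ            ≤⟨ ℚ.+-monoˡ-≤ (- 1ℚ) (ℚ.+-mono-≤ ℓ≤2R ℓ≤2R) ⟩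
  (2ℚ * R + 2ℚ * R) - 1ℚ          ≡⟨ cong (_- 1ℚ) (solve 1 (λ R → con 2ℚ :* R :+ con 2ℚ :* R := con (ℕ→ℚ 4) :* R :* con 1ℚ) refl R) ⟩
  ℕ→ℚ 4 * R * 1ℚ - 1ℚ             ≡⟨ cong (λ w → ℕ→ℚ 4 * R * w - 1ℚ) (sym Nr≡1) ⟩
  ℕ→ℚ 4 * R * (N * r) - 1ℚ        ≡⟨ cong (_- 1ℚ) (solve 3 (λ R N r → con (ℕ→ℚ 4) :* R :* (N :* r) := N :* (con (ℕ→ℚ 4) :* (R :* r))) refl R N r) ⟩
  N * (ℕ→ℚ 4 * (R * r)) - 1ℚ      ≤⟨ ℚ.+-monoˡ-≤ (- 1ℚ) (*-monoˡ (0≤ℕ→ℚ (suc n)) h) ⟩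
  N * (x + r) - 1ℚ                ≡⟨ cong (_- 1ℚ) (ℚ.*-distribˡ-+ N x r) ⟩
  (N * x + N * r) - 1ℚ            ≡⟨ cong (λ w → (N * x + w) - 1ℚ) Nr≡1 ⟩
  (N * x + 1ℚ) - 1ℚ               ≡⟨ solve 1 (λ z → (z :+ con 1ℚ) :- con 1ℚ := z) refl (N * x) ⟩
  N * x                           ∎
  where
  open ℚ.≤-Reasoning
  N R r : ℚ
  N = ℕ→ℚ (suc n)
  r = recip N
  R = riemann (suc k) N
  Nr≡1 : N * r ≡ 1ℚ
  Nr≡1 = *-recip (0<ℕ→ℚ n)
  ℓ≤2R : ℕ→ℚ ℓ ≤ℚ 2ℚ * R
  ℓ≤2R = riemann-lower k (ℕ→ℚ-mono {1} {suc n} (s≤s z≤n)) ℓ (ℕ→ℚ-mono 2^ℓ≤n)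

-- 24 = 2 · 6 · 2, from riemann-upper, D ≤ 2^(6 j) and riemann-lower.
log-ratio-bound : ∀ n k j T {y} → 1ℚ ≤ℚ y → ℕ→ℚ (2 ℕ.^ j) ≤ℚ y → 1 ≤ j →
  suc n ≤ 2 ℕ.^ (6 ℕ.* j ℕ.* T) → suc n ≤ suc k →
  recip (ℕ→ℚ 24) * (riemann (suc k) (ℕ→ℚ (suc n)) * recip (riemann (suc k) y)) ≤ℚ ℕ→ℚ T
log-ratio-bound n k j@(suc j′) T {y} 1≤y 2^j≤y 1≤j n≤2^ n≤k = begin
  c * (riemann (suc k) (ℕ→ℚ (suc n)) * recip Ry)
    ≤⟨ *-monoˡ 0≤c (*-monoʳ (ℚ.<⇒≤ (recip-pos 0<Ry)) Rn≤) ⟩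
  c * (2ℚ * ℕ→ℚ (6 ℕ.* j ℕ.* T) * recip Ry)
    ≤⟨ *-monoˡ 0≤c (*-monoˡ (0≤* (0≤ℕ→ℚ 2) (0≤ℕ→ℚ (6 ℕ.* j ℕ.* T))) (recip-≤ 0<Ry 1≤Ry*s)) ⟩
  c * (2ℚ * ℕ→ℚ (6 ℕ.* j ℕ.* T) * s)
    ≡⟨ cong (λ w → c * (2ℚ * w * s)) (trans (ℕ→ℚ-* (6 ℕ.* j) T) (cong (_* ℕ→ℚ T) (ℕ→ℚ-* 6 j))) ⟩
  c * (2ℚ * (ℕ→ℚ 6 * J * ℕ→ℚ T) * (2ℚ * recip J))
    ≡⟨ solve 4 (λ c J T r → c :* (con 2ℚ :* (con (ℕ→ℚ 6) :* J :* T) :* (con 2ℚ :* r)) := (con (ℕ→ℚ 24) :* c) :* (J :* r) :* T)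
         refl c J (ℕ→ℚ T) (recip J) ⟩
  (ℕ→ℚ 24 * c) * (J * recip J) * ℕ→ℚ T
    ≡⟨ cong₂ (λ v w → v * w * ℕ→ℚ T) (*-recip (0<ℕ→ℚ 23)) (*-recip (0<ℕ→ℚ j′)) ⟩
  1ℚ * 1ℚ * ℕ→ℚ T
    ≡⟨ ℚ.*-identityˡ (ℕ→ℚ T) ⟩
  ℕ→ℚ T ∎
  where
  open ℚ.≤-Reasoning
  c J s Ry : ℚ
  c = recip (ℕ→ℚ 24)
  J = ℕ→ℚ j
  s = 2ℚ * recip J
  Ry = riemann (suc k) y
  0≤c : 0ℚ ≤ℚ c
  0≤c = ℚ.<⇒≤ (recip-pos (0<ℕ→ℚ 23))
  J≤2Ry : J ≤ℚ 2ℚ * Ry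
  J≤2Ry = riemann-lower k 1≤y j 2^j≤y
  0<Ry : 0ℚ <ℚ Ry
  0<Ry = ℚ.*-cancelˡ-<-nonNeg 2ℚ (ℚ.<-≤-trans (0<ℕ→ℚ j′) J≤2Ry)
  1≤Ry*s : 1ℚ ≤ℚ Ry * s
  1≤Ry*s = begin
    1ℚ                     ≡⟨ sym (*-recip (0<ℕ→ℚ j′)) ⟩
    J * recip J            ≤⟨ *-monoʳ (ℚ.<⇒≤ (recip-pos (0<ℕ→ℚ j′))) J≤2Ry ⟩
    2ℚ * Ry * recip J      ≡⟨ solve 2 (λ R r → con 2ℚ :* R :* r := R :* (con 2ℚ :* r)) refl Ry (recip J) ⟩
    Ry * s                 ∎
  Rn≤ : riemann (suc k) (ℕ→ℚ (suc n)) ≤ℚ 2ℚ * ℕ→ℚ (6 ℕ.* j ℕ.* T)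
  Rn≤ = riemann-upper k (ℕ→ℚ-mono {1} {suc n} (s≤s z≤n)) (6 ℕ.* j ℕ.* T) (ℕ→ℚ-mono n≤2^) (ℕ→ℚ-mono n≤k)

-- The stationary edge-MEG

does-false : ∀ {A : Set} (A? : Dec A) → not (does A?) ≡ true → ¬ A
does-false (no ¬a) _ = ¬a

≤⇒≤+ : ∀ x y {e} → 0ℚ <ℚ e → x ≤ℚ y → x ≤ℚ y + e
≤⇒≤+ x y {e} 0<e x≤y = ℚ.≤-trans x≤y (subst (_≤ℚ y + e) (ℚ.+-identityʳ y) (ℚ.+-monoʳ-≤ y (ℚ.<⇒≤ 0<e)))

-- There are suc n nodes, and y stands for their number times p̂.
record Scale (n : ℕ) (y : ℝ) : Set where
  field
    ℓ m j K : ℕ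

  D : ℕ
  D = threshold m ℓ

  field
    -- The upper bound m on y serves the degree tail, the lower bound 2^j serves log y. `D≤2^` ties
    -- them together: log₂ D ≤ 6 j, while the terms of log y are at least j / 2.
    n≤2^ℓ : suc n ≤ 2 ℕ.^ ℓ
    2≤D   : 2 ≤ D
    D≤2^  : D ≤ 2 ℕ.^ (6 ℕ.* j)
    1≤j   : 1 ≤ j
    y≤m   : ∀ k → K ≤ k → seq y k ≤ℚ ℕ→ℚ m
    2^j≤y : ∀ k → K ≤ k → ℕ→ℚ (2 ℕ.^ j) ≤ℚ seq y k

  1≤y : ∀ k → K ≤ k → 1ℚ ≤ℚ seq y k
  1≤y k K≤k = ℚ.≤-trans (ℕ→ℚ-mono {1} {2 ℕ.^ j} (ℕ.m^n>0 2 j)) (2^j≤y k K≤k)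

  log-pos : ∀ 0<y → 0ℝ <ℝ log y 0<y
  log-pos 0<y = pos-from-bound {log y 0<y} (½ , ℚ.positive⁻¹ ½ , K , λ k K≤k → *-cancelˡ {2ℚ} (0<ℕ→ℚ 1)
    (ℚ.≤-trans (ℕ→ℚ-mono {1} {j} 1≤j) (riemann-lower k (1≤y k K≤k) j (2^j≤y k K≤k))))

  smallDegree : Pairs (Vec Bool (suc n)) (suc n) → Bool
  smallDegree X = not (does (largeDegree? D X))

  smallDegree⇒slow : ∀ 0<n 0<y 0<log-y X → smallDegree (prefix n X) ≡ true →
    FloodingTime≥ (inv (fromℕ 24) (fromℕ-pos 24) *ℝ (log (fromℕ (suc n)) 0<n /ℝ log y 0<y [ 0<log-y ])) X
  -- The index must also reach n, because `riemann-upper` at the point n + 1 needs a partition into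
  -- at least n + 1 steps.
  smallDegree⇒slow 0<n 0<y 0<log-y X good T flood ε 0<ε = K ℕ.⊔ n , λ k ≤k →
    let K≤k = ℕ.m⊔n≤o⇒m≤o K n ≤k in
    ≤⇒≤+ (recip (ℕ→ℚ 24) * (riemann (suc k) (ℕ→ℚ (suc n)) * recip (riemann (suc k) (seq y k)))) (ℕ→ℚ T) 0<ε
      (log-ratio-bound n k j T {seq y k} (1≤y k K≤k) (2^j≤y k K≤k) 1≤j n≤2^ (s≤s (ℕ.m⊔n≤o⇒n≤o K n ≤k)))
    where
    n≤2^ : suc n ≤ 2 ℕ.^ (6 ℕ.* j ℕ.* T)
    n≤2^ = ℕ.≤-trans (flooding-size D X 2≤D (does-false (largeDegree? D (prefix n X)) good) T flood)
      (ℕ.≤-trans (ℕ.^-monoˡ-≤ T D≤2^) (ℕ.≤-reflexive (ℕ.^-*-assoc 2 (6 ℕ.* j) T)))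

-- From ℓ ≤ y ≤ m at one late index, m is at least ℓ, hence at least 5. Removing the slack 3 of
-- `eventual-ceiling` leaves m′ ≥ 2 with m′ ≤ y eventually, so its binary logarithm j is at least 1
-- and y stays at least 2. This is where positivity of log y comes from.
mkScale : ∀ n (y : ℝ) ℓ → 5 ≤ ℓ → suc n ≤ 2 ℕ.^ ℓ →
          (∃ λ N → ∀ k → N ≤ k → ℕ→ℚ ℓ ≤ℚ seq y k) → Scale n y
mkScale n y ℓ 5≤ℓ n≤2^ℓ (N₁ , ℓ≤y) =
  let m , N₂ , ceil = eventual-ceiling y (N₁ , λ k N₁≤k → ℚ.≤-trans (0≤ℕ→ℚ ℓ) (ℓ≤y k N₁≤k))
      K   = N₁ ℕ.⊔ N₂
      ℓ≤m = ℕ→ℚ-cancel-≤ (ℚ.≤-trans (ℓ≤y K (ℕ.m≤m⊔n N₁ N₂)) (proj₁ (ceil K (ℕ.m≤n⊔m N₁ N₂))))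
  in build m ℓ≤m (ℕ.≤-trans 5≤ℓ ℓ≤m) K (λ k K≤k → ceil k (ℕ.m⊔n≤o⇒n≤o N₁ N₂ K≤k))
  where
  build : ∀ m → ℓ ≤ m → 5 ≤ m → ∀ K →
          (∀ k → K ≤ k → seq y k ≤ℚ ℕ→ℚ m × ℕ→ℚ m ≤ℚ seq y k + ℕ→ℚ 3) → Scale n y
  build m@(suc (suc (suc m′@(suc m″)))) ℓ≤m (s≤s (s≤s (s≤s 2≤m′))) K ceil =
    let j , 2^j≤m′ , m′<2^ = binaryLog m″
        1≤j = ℕ.s≤s⁻¹ (^-cancelʳ-< {1} {suc j} (ℕ.≤-<-trans 2≤m′ m′<2^))
    in record
      { ℓ = ℓ ; m = m ; j = j ; K = K ; n≤2^ℓ = n≤2^ℓ ; 1≤j = 1≤j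
      ; 2≤D   = ℕ.≤-trans (s≤s (s≤s z≤n)) (ℕ.≤-trans (ℕ.m≤m+n m m) (ℕ.m≤m+n (m ℕ.+ m) (ℓ ℕ.+ (ℓ ℕ.+ ℓ))))
      ; D≤2^  = threshold≤2^ m′ ℓ j ℓ≤m m′<2^ 1≤j
      ; y≤m   = λ k K≤k → proj₁ (ceil k K≤k)
      ; 2^j≤y = λ k K≤k → ℚ.≤-trans (ℕ→ℚ-mono 2^j≤m′) (m′≤ (seq y k) (proj₂ (ceil k K≤k)))
      }
    where
    open ℚ.≤-Reasoning
    m′≤ : ∀ x → ℕ→ℚ (3 ℕ.+ m′) ≤ℚ x + ℕ→ℚ 3 → ℕ→ℚ m′ ≤ℚ x
    m′≤ x h = begin
      ℕ→ℚ m′                    ≡⟨ solve 1 (λ x → x := (con (ℕ→ℚ 3) :+ x) :- con (ℕ→ℚ 3)) refl (ℕ→ℚ m′) ⟩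
      ℕ→ℚ 3 + ℕ→ℚ m′ - ℕ→ℚ 3    ≡⟨ cong (_- ℕ→ℚ 3) (sym (ℕ→ℚ-+ 3 m′)) ⟩
      ℕ→ℚ (3 ℕ.+ m′) - ℕ→ℚ 3    ≤⟨ ℚ.+-monoˡ-≤ (- ℕ→ℚ 3) h ⟩
      x + ℕ→ℚ 3 - ℕ→ℚ 3         ≡⟨ solve 1 (λ x → (x :+ con (ℕ→ℚ 3)) :- con (ℕ→ℚ 3) := x) refl x ⟩
      x                         ∎

seq-fromℕ-* : ∀ n x k → seq (fromℕ n *ℝ x) k ≡ ℕ→ℚ n * seq x k
seq-fromℕ-* n x k = refl

module StationaryMEG (n : ℕ) (p q : ℝ) (0<p : 0ℝ <ℝ p) (p<1 : p <ℝ 1ℝ) (0<q : 0ℝ <ℝ q) (q<1 : q <ℝ 1ℝ) where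

  density-scale : 16 ≤ suc n →
    fromℕ 4 *ℝ (log (fromℕ (suc n)) (fromℕ-pos (suc n)) /ℝ fromℕ (suc n) [ fromℕ-pos (suc n) ]) ≤ℝ stationaryDensity p q 0<p 0<q →
    Scale n (fromℕ (suc n) *ℝ stationaryDensity p q 0<p 0<q)
  density-scale 16≤n dense =
    let ℓ , 2^ℓ≤n , n<2^ = binaryLog n
        -- From 2^4 ≤ n + 1 < 2^(ℓ+1).
        5≤1+ℓ = ^-cancelʳ-< {4} {suc ℓ} (ℕ.≤-<-trans 16≤n n<2^)
        -- This choice of slack in p̂ costs exactly 1 after multiplication by the number of nodes.
        N , dense′ = dense (recip (ℕ→ℚ (suc n))) (recip-pos (0<ℕ→ℚ n))
    in mkScale n (fromℕ (suc n) *ℝ stationaryDensity p q 0<p 0<q) (suc ℓ) 5≤1+ℓ (ℕ.<⇒≤ n<2^)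
      (N , λ k N≤k → subst (ℕ→ℚ (suc ℓ) ≤ℚ_) (sym (seq-fromℕ-* (suc n) (stationaryDensity p q 0<p 0<q) k))
        (density-≥-log n ℓ k {seq (stationaryDensity p q 0<p 0<q) k} 2^ℓ≤n
          (ℕ.≤-trans (s≤s (s≤s z≤n)) (ℕ.s≤s⁻¹ 5≤1+ℓ)) (dense′ k N≤k)))

  module _ (S : Scale n (fromℕ (suc n) *ℝ stationaryDensity p q 0<p 0<q)) where
    open Scale S

    Pr-smallDegree-at : ∀ k → K ≤ k → 0ℚ <ℚ seq p k → seq p k ≤ℚ 1ℚ → 0ℚ <ℚ seq q k → seq q k ≤ℚ 1ℚ →
      1ℚ - recip (ℕ→ℚ (suc n)) ≤ℚ seq (Pr (edgeMEG p q 0<p 0<q (suc n) n) smallDegree) k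
    Pr-smallDegree-at k K≤k 0<pₖ pₖ≤1 0<qₖ qₖ≤1 = ℚ.≤-trans
      (ℚ.+-monoʳ-≤ 1ℚ (ℚ.neg-antimono-≤ (tail-small n m ℓ {p̂ₖ} 0≤p̂ₖ np̂≤m n≤2^ℓ)))
      (Expectation.Pr-maxDegree k p q 0<p 0<q 0<pₖ pₖ≤1 0<qₖ qₖ≤1 n n D)
      where
      p̂ₖ : ℚ
      p̂ₖ = seq (stationaryDensity p q 0<p 0<q) k
      0≤p̂ₖ : 0ℚ ≤ℚ p̂ₖ
      0≤p̂ₖ = Expectation.0≤density k p q 0<p 0<q 0<pₖ pₖ≤1 0<qₖ qₖ≤1
      np̂≤m : ℕ→ℚ n * p̂ₖ ≤ℚ ℕ→ℚ m
      np̂≤m = ℚ.≤-trans (*-monoʳ {p̂ₖ} {ℕ→ℚ n} {ℕ→ℚ (suc n)} 0≤p̂ₖ (ℕ→ℚ-mono (ℕ.n≤1+n n)))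
        (subst (_≤ℚ ℕ→ℚ m) (seq-fromℕ-* (suc n) (stationaryDensity p q 0<p 0<q) k) (y≤m k K≤k))

    Pr-smallDegree : 1ℝ -ℝ (1ℝ /ℝ fromℕ (suc n) [ fromℕ-pos (suc n) ]) ≤ℝ Pr (edgeMEG p q 0<p 0<q (suc n) n) smallDegree
    Pr-smallDegree e 0<e =
      let δ , 0<δ , Np , δ≤p = bounded-below {p} 0<p
          γ , 0<γ , Nq , γ≤q = bounded-below {q} 0<q
          ε , 0<ε , Np′ , p≤1 = p<1
          η , 0<η , Nq′ , q≤1 = q<1
      -- Beyond this index the k-th terms of p and q lie in (0, 1], so the k-th weights define a
      -- genuine Markov chain.
      in K ℕ.⊔ ((Np ℕ.⊔ Nq) ℕ.⊔ (Np′ ℕ.⊔ Nq′)) , λ k ≤k →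
        let K≤k = ℕ.m⊔n≤o⇒m≤o K ((Np ℕ.⊔ Nq) ℕ.⊔ (Np′ ℕ.⊔ Nq′)) ≤k
            ≤k′ = ℕ.m⊔n≤o⇒n≤o K ((Np ℕ.⊔ Nq) ℕ.⊔ (Np′ ℕ.⊔ Nq′)) ≤k
            l = ℕ.m⊔n≤o⇒m≤o (Np ℕ.⊔ Nq) (Np′ ℕ.⊔ Nq′) ≤k′
            r = ℕ.m⊔n≤o⇒n≤o (Np ℕ.⊔ Nq) (Np′ ℕ.⊔ Nq′) ≤k′
            P = seq (Pr (edgeMEG p q 0<p 0<q (suc n) n) smallDegree) k
        in ≤⇒≤+ (1ℚ - 1ℚ * recip (ℕ→ℚ (suc n))) P 0<e
             (subst (λ w → 1ℚ - w ≤ℚ P) (sym (ℚ.*-identityˡ (recip (ℕ→ℚ (suc n)))))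
               (Pr-smallDegree-at k K≤k
                 (ℚ.<-≤-trans 0<δ (δ≤p k (ℕ.m⊔n≤o⇒m≤o Np Nq l)))
                 (ℚ.≤-trans (≤⇒≤+ (seq p k) (seq p k) 0<ε ℚ.≤-refl) (p≤1 k (ℕ.m⊔n≤o⇒m≤o Np′ Nq′ r)))
                 (ℚ.<-≤-trans 0<γ (γ≤q k (ℕ.m⊔n≤o⇒n≤o Np Nq l)))
                 (ℚ.≤-trans (≤⇒≤+ (seq q k) (seq q k) 0<η ℚ.≤-refl) (q≤1 k (ℕ.m⊔n≤o⇒n≤o Np′ Nq′ r)))))

    slow-whp : ∀ 0<np̂ 0<log-np̂ → WithProbability≥ p q 0<p 0<q (suc n) (1ℝ -ℝ (1ℝ /ℝ fromℕ (suc n) [ fromℕ-pos (suc n) ]))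
      (FloodingTime≥ (inv (fromℕ 24) (fromℕ-pos 24) *ℝ (log (fromℕ (suc n)) (fromℕ-pos (suc n)) /ℝ
        log (fromℕ (suc n) *ℝ stationaryDensity p q 0<p 0<q) 0<np̂ [ 0<log-np̂ ])))
    slow-whp 0<np̂ 0<log-np̂ = n , smallDegree , smallDegree⇒slow (fromℕ-pos (suc n)) 0<np̂ 0<log-np̂ , Pr-smallDegree

mainTheorem14 :
    ∃ λ (c : ℝ) → ∃ λ (C : ℝ) → 0ℝ <ℝ c × 0ℝ <ℝ C ×
    ∃ λ (n₀ : ℕ) → ∀ (n : ℕ) .{{_ : NonZero n}} → n₀ ≤ n →
    ∀ (p q : ℝ) (0<p : 0ℝ <ℝ p) (p<1 : p <ℝ 1ℝ) (0<q : 0ℝ <ℝ q) (q<1 : q <ℝ 1ℝ) →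
    let n>0 = fromℕ-pos n
        p̂ = stationaryDensity p q 0<p 0<q
        log-n = log (fromℕ n) n>0
        log-np̂ = log (fromℕ n *ℝ p̂) (*ℝ-pos {fromℕ n} {p̂} n>0 (stationaryDensity-pos p q 0<p 0<q))
    in c *ℝ (log-n /ℝ fromℕ n [ n>0 ]) ≤ℝ p̂ →
       Σ (0ℝ <ℝ log-np̂) λ log-np̂>0 →
         WithProbability≥ p q 0<p 0<q n (1ℝ -ℝ (1ℝ /ℝ fromℕ n [ n>0 ]))
           (FloodingTime≥ (C *ℝ (log-n /ℝ log-np̂ [ log-np̂>0 ])))
-- The constant 4 is fixed by `density-≥-log`, 24 by `log-ratio-bound`, and 16 by the requirement 5
-- ≤ ℓ of `mkScale`.
mainTheorem14 = fromℕ 4 , inv (fromℕ 24) (fromℕ-pos 24) , fromℕ-pos 4 , inv-pos {fromℕ 24} (fromℕ-pos 24) , 16 ,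
  λ { zero () ; (suc n) 16≤n p q 0<p p<1 0<q q<1 dense →
    let open StationaryMEG n p q 0<p p<1 0<q q<1
        p̂ = stationaryDensity p q 0<p 0<q
        S = density-scale 16≤n dense
        0<n = fromℕ-pos (suc n)
        0<np̂ = *ℝ-pos {fromℕ (suc n)} {p̂} 0<n (stationaryDensity-pos p q 0<p 0<q)
        0<log-np̂ = Scale.log-pos S 0<np̂
    in 0<log-np̂ , slow-whp S 0<np̂ 0<log-np̂ }
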